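{- Let $d>3$ be an integer. There is a constant $c_d>0$ such that for all positive integers $n>3$, the maximum, over all sets $\mathcal{O}$ of obstructing unit $d$-hypercubes in $[0,n]^d$, of the number of hypercubes in $\mathcal{O}$ that are visible from the observing unit $d$-hypercube $[0,1]^d$ is at least $c_d\,n^{d-\frac1d}$.
   Context: The hypercube $[0,n]^d$ is partitioned into $n^d$ axis-aligned unit $d$-hypercubes $\prod_{i=1}^d[a_i,a_i+1]$ with $a_i\in\{0,\dots,n-1\}$. The observer is the unit hypercube $[0,1]^d$ adjacent to the origin. A configuration is a set $\mathcal{O}$ of unit hypercubes of this partition, different from the observer, that are declared obstructing; all other hypercubes are empty and lines of sight pass through them freely. An obstructing hypercube $Q\in\mathcal{O}$ is visible from the observer if there are a point $x$ of the observer hypercube and a point $y\in Q$ such that the line segment from $x$ to $y$ is unobstructed, i.e. it does not meet any obstructing hypercube $Q'\in\mathcal{O}$ with $Q'\neq Q$. -}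

module Defs where

open import Data.Fin.Base using (Fin; toℕ)
open import Data.Integer.Base as ℤ using (+_)
import Data.Integer.Properties as ℤ
import Data.Integer.Solver as ℤ-Solver
open import Data.List.Base using (List; length)
open import Data.List.Membership.Propositional using (_∈_)
open import Data.List.Relation.Unary.Unique.Propositional using (Unique)
open import Data.Nat.Base as ℕ using (ℕ; zero; suc; _^_)
import Data.Nat.Properties as ℕ
open import Data.Product.Base using (Σ; ∃; _×_; _,_)
open import Data.Rational.Base as ℚ using (ℚ; 0ℚ; 1ℚ; ½; mkℚ; _/_; ∣_∣)
import Data.Rational.Properties as ℚ
import Data.Rational.Unnormalised.Base as ℚᵘ
import Data.Rational.Unnormalised.Properties as ℚᵘ
open import Data.Rational.Solver using (module +-*-Solver)
open import Data.Sum.Base using (inj₁; inj₂)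
open import Data.Vec.Base using (Vec; lookup)
open import Function.Bundles using (_⇔_)
open import Relation.Binary.PropositionalEquality
open import Relation.Nullary.Decidable using (yes; no)
open import Relation.Nullary.Negation using (¬_; contradiction)

------------------------------------------------------------------------
-- Real numbers, as Cauchy sequences of rationals.  Equality of reals is
-- not needed below; distinct sequences may represent the same real.

IsCauchy : (ℕ → ℚ) → Set
IsCauchy x = ∀ ε → 0ℚ ℚ.< ε →
  ∃ λ N → ∀ {m n} → N ℕ.≤ m → N ℕ.≤ n → ∣ x m ℚ.- x n ∣ ℚ.< ε

record ℝ : Set where
  constructor mkℝ
  field
    seq    : ℕ → ℚ
    cauchy : IsCauchy seq

open ℝ public

infix  4 _≤ᵣ_ _<ᵣ_
infixl 6 _+ᵣ_ _-ᵣ_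
infixl 7 _*ᵣ_
infix  8 -ᵣ_

_≤ᵣ_ : ℝ → ℝ → Set
x ≤ᵣ y = ∀ ε → 0ℚ ℚ.< ε →
  ∃ λ N → ∀ {k} → N ℕ.≤ k → seq x k ℚ.≤ seq y k ℚ.+ ε

_<ᵣ_ : ℝ → ℝ → Set
x <ᵣ y = ∃ λ ε → 0ℚ ℚ.< ε ×
  ∃ λ N → ∀ {k} → N ℕ.≤ k → seq x k ℚ.+ ε ℚ.≤ seq y k

fromℚ : ℚ → ℝ
fromℚ q = mkℝ (λ _ → q) λ ε ε>0 →
  0 , λ _ _ → subst (λ z → ∣ z ∣ ℚ.< ε) (sym (ℚ.+-inverseʳ q)) ε>0

fromℕ : ℕ → ℝ
fromℕ n = fromℚ (+ n / 1)

half>0 : ∀ {ε} → 0ℚ ℚ.< ε → 0ℚ ℚ.< ½ ℚ.* ε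
half>0 {ε} ε>0 = subst (ℚ._< ½ ℚ.* ε) (ℚ.*-zeroʳ ½) (ℚ.*-monoʳ-<-pos ½ ε>0)

half+half : ∀ ε → ½ ℚ.* ε ℚ.+ ½ ℚ.* ε ≡ ε
half+half ε = trans (sym (ℚ.*-distribʳ-+ ε ½ ½)) (ℚ.*-identityˡ ε)

_+ᵣ_ : ℝ → ℝ → ℝ
x +ᵣ y = mkℝ (λ k → seq x k ℚ.+ seq y k) λ ε ε>0 →
  let Nx , hx = cauchy x (½ ℚ.* ε) (half>0 ε>0)
      Ny , hy = cauchy y (½ ℚ.* ε) (half>0 ε>0)
  in Nx ℕ.⊔ Ny , λ {m} {n} N≤m N≤n →
    let open ℚ.≤-Reasoning
        a = seq x m ; b = seq x n ; c = seq y m ; d = seq y n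
    in begin-strict
    ∣ (a ℚ.+ c) ℚ.- (b ℚ.+ d) ∣
      ≡⟨ cong ∣_∣ (+-*-Solver.solve 4 (λ a b c d →
           let open +-*-Solver in
           (a :+ c) :- (b :+ d) := (a :- b) :+ (c :- d)) refl a b c d) ⟩
    ∣ (a ℚ.- b) ℚ.+ (c ℚ.- d) ∣
      ≤⟨ ℚ.∣p+q∣≤∣p∣+∣q∣ (a ℚ.- b) (c ℚ.- d) ⟩
    ∣ a ℚ.- b ∣ ℚ.+ ∣ c ℚ.- d ∣
      <⟨ ℚ.+-mono-<
           (hx (ℕ.m⊔n≤o⇒m≤o Nx Ny N≤m) (ℕ.m⊔n≤o⇒m≤o Nx Ny N≤n))
           (hy (ℕ.m⊔n≤o⇒n≤o Nx Ny N≤m) (ℕ.m⊔n≤o⇒n≤o Nx Ny N≤n)) ⟩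
    ½ ℚ.* ε ℚ.+ ½ ℚ.* ε
      ≡⟨ half+half ε ⟩
    ε ∎

-ᵣ_ : ℝ → ℝ
-ᵣ x = mkℝ (λ k → ℚ.- seq x k) λ ε ε>0 →
  let N , h = cauchy x ε ε>0
  in N , λ {m} {n} N≤m N≤n →
    subst (ℚ._< ε)
      (trans (sym (ℚ.∣-p∣≡∣p∣ (seq x m ℚ.- seq x n)))
             (cong ∣_∣ (ℚ.neg-distrib-+ (seq x m) (ℚ.- seq x n))))
      (h N≤m N≤n)

_-ᵣ_ : ℝ → ℝ → ℝ
x -ᵣ y = x +ᵣ (-ᵣ y)

bounded : ∀ x → ∃ λ B → 0ℚ ℚ.< B ×
          ∃ λ N → ∀ {k} → N ℕ.≤ k → ∣ seq x k ∣ ℚ.≤ B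
bounded x =
  let N , h = cauchy x 1ℚ (ℚ.positive⁻¹ 1ℚ)
      a = seq x N
  in 1ℚ ℚ.+ ∣ a ∣
   , ℚ.+-mono-<-≤ (ℚ.positive⁻¹ 1ℚ) (ℚ.0≤∣p∣ a)
   , N , λ {k} N≤k →
     let open ℚ.≤-Reasoning
         b = seq x k
     in begin
     ∣ b ∣
       ≡⟨ cong ∣_∣ (+-*-Solver.solve 2 (λ a b →
            let open +-*-Solver in b := (b :- a) :+ a) refl a b) ⟩
     ∣ (b ℚ.- a) ℚ.+ a ∣
       ≤⟨ ℚ.∣p+q∣≤∣p∣+∣q∣ (b ℚ.- a) a ⟩
     ∣ b ℚ.- a ∣ ℚ.+ ∣ a ∣
       ≤⟨ ℚ.+-monoˡ-≤ ∣ a ∣ (ℚ.<⇒≤ (h N≤k ℕ.≤-refl)) ⟩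
     1ℚ ℚ.+ ∣ a ∣ ∎

shrink : ∀ B ε → 0ℚ ℚ.< B → 0ℚ ℚ.< ε →
         ∃ λ δ → 0ℚ ℚ.< δ × B ℚ.* δ ≡ ½ ℚ.* ε
shrink B ε B>0 ε>0 = 1/B ℚ.* h , δ>0 ,
  trans (sym (ℚ.*-assoc B 1/B h))
        (trans (cong (ℚ._* h) (ℚ.*-inverseʳ B)) (ℚ.*-identityˡ h))
  where
  instance
    B-pos = ℚ.positive B>0
    B≢0   = ℚ.pos⇒nonZero B
  h   = ½ ℚ.* ε
  1/B = ℚ.1/ B
  instance
    1/B-pos = ℚ.1/pos⇒pos B
  δ>0 : 0ℚ ℚ.< 1/B ℚ.* h
  δ>0 = subst (ℚ._< 1/B ℚ.* h) (ℚ.*-zeroʳ 1/B) (ℚ.*-monoʳ-<-pos 1/B (half>0 ε>0))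

*-small : ∀ p q {B δ} → 0ℚ ℚ.< B → ∣ p ∣ ℚ.≤ B → ∣ q ∣ ℚ.< δ →
          ∣ p ℚ.* q ∣ ℚ.< B ℚ.* δ
*-small p q {B} {δ} B>0 p≤B q<δ = begin-strict
  ∣ p ℚ.* q ∣      ≡⟨ ℚ.∣p*q∣≡∣p∣*∣q∣ p q ⟩
  ∣ p ∣ ℚ.* ∣ q ∣  ≤⟨ ℚ.*-monoʳ-≤-nonNeg ∣ q ∣ {{ℚ.∣-∣-nonNeg q}} p≤B ⟩
  B ℚ.* ∣ q ∣      <⟨ ℚ.*-monoʳ-<-pos B {{ℚ.positive B>0}} q<δ ⟩
  B ℚ.* δ          ∎
  where open ℚ.≤-Reasoning

_*ᵣ_ : ℝ → ℝ → ℝ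
x *ᵣ y = mkℝ (λ k → seq x k ℚ.* seq y k) λ ε ε>0 →
  let Bx , Bx>0 , Mx , bx = bounded x
      By , By>0 , My , by = bounded y
      δx , δx>0 , ex = shrink By ε By>0 ε>0
      δy , δy>0 , ey = shrink Bx ε Bx>0 ε>0
      Nx , hx = cauchy x δx δx>0
      Ny , hy = cauchy y δy δy>0
      M = Mx ℕ.⊔ My
      N = Nx ℕ.⊔ Ny
  in M ℕ.⊔ N , λ {m} {n} le le′ →
    let open ℚ.≤-Reasoning
        a = seq x m ; b = seq x n ; c = seq y m ; d = seq y n
        M≤m = ℕ.m⊔n≤o⇒m≤o M N le
        M≤n = ℕ.m⊔n≤o⇒m≤o M N le′
        N≤m = ℕ.m⊔n≤o⇒n≤o M N le
        N≤n = ℕ.m⊔n≤o⇒n≤o M N le′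
    in begin-strict
    ∣ a ℚ.* c ℚ.- b ℚ.* d ∣
      ≡⟨ cong ∣_∣ (+-*-Solver.solve 4 (λ a b c d →
           let open +-*-Solver in
           a :* c :- b :* d := a :* (c :- d) :+ d :* (a :- b)) refl a b c d) ⟩
    ∣ a ℚ.* (c ℚ.- d) ℚ.+ d ℚ.* (a ℚ.- b) ∣
      ≤⟨ ℚ.∣p+q∣≤∣p∣+∣q∣ (a ℚ.* (c ℚ.- d)) (d ℚ.* (a ℚ.- b)) ⟩
    ∣ a ℚ.* (c ℚ.- d) ∣ ℚ.+ ∣ d ℚ.* (a ℚ.- b) ∣
      <⟨ ℚ.+-mono-<
           (*-small a (c ℚ.- d) Bx>0 (bx (ℕ.m⊔n≤o⇒m≤o Mx My M≤m))
             (hy (ℕ.m⊔n≤o⇒n≤o Nx Ny N≤m) (ℕ.m⊔n≤o⇒n≤o Nx Ny N≤n)))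
           (*-small d (a ℚ.- b) By>0 (by (ℕ.m⊔n≤o⇒n≤o Mx My M≤n))
             (hx (ℕ.m⊔n≤o⇒m≤o Nx Ny N≤m) (ℕ.m⊔n≤o⇒m≤o Nx Ny N≤n))) ⟩
    Bx ℚ.* δy ℚ.+ By ℚ.* δx
      ≡⟨ cong₂ ℚ._+_ ey ex ⟩
    ½ ℚ.* ε ℚ.+ ½ ℚ.* ε
      ≡⟨ half+half ε ⟩
    ε ∎

------------------------------------------------------------------------
-- Fractional powers of natural numbers

-- The largest b ≤ u with b ^ q ≤ a, or 0 if there is none.
rootUpTo : ℕ → ℕ → ℕ → ℕ
rootUpTo q a zero    = zero
rootUpTo q a (suc u) with suc u ^ q ℕ.≤? a
... | yes _ = suc u
... | no  _ = rootUpTo q a u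

-- ⌊ a ^ (1/q) ⌋ for q ≥ 1
⌊root⌋ : ℕ → ℕ → ℕ
⌊root⌋ q a = rootUpTo q a a

-- The k-th approximation of a ^ (1/q) is ⌊ (k+1) a ^ (1/q) ⌋ / (k+1).
rootNum : ℕ → ℕ → ℕ → ℕ
rootNum q a k = ⌊root⌋ q (a ℕ.* suc k ^ q)

rootSeq : ℕ → ℕ → ℕ → ℚ
rootSeq q a k = + rootNum q a k / suc k

rootUpTo-lower : ∀ q .{{_ : ℕ.NonZero q}} a u → rootUpTo q a u ^ q ℕ.≤ a
rootUpTo-lower (suc q) a zero = ℕ.z≤n
rootUpTo-lower q a (suc u) with suc u ^ q ℕ.≤? a
... | yes le = le
... | no  _  = rootUpTo-lower q a u

rootUpTo-upper : ∀ q a u → a ℕ.< suc u ^ q → a ℕ.< suc (rootUpTo q a u) ^ q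
rootUpTo-upper q a zero    lt = lt
rootUpTo-upper q a (suc u) lt with suc u ^ q ℕ.≤? a
... | yes _ = lt
... | no  p = rootUpTo-upper q a u (ℕ.≰⇒> p)

rootNum-lower : ∀ q .{{_ : ℕ.NonZero q}} a k →
                rootNum q a k ^ q ℕ.≤ a ℕ.* suc k ^ q
rootNum-lower q a k = rootUpTo-lower q A A
  where A = a ℕ.* suc k ^ q

rootNum-upper : ∀ q .{{_ : ℕ.NonZero q}} a k →
                a ℕ.* suc k ^ q ℕ.< suc (rootNum q a k) ^ q
rootNum-upper q a k = rootUpTo-upper q A A
  (ℕ.<-≤-trans (ℕ.n<1+n A)
    (subst (ℕ._≤ suc A ^ q) (ℕ.*-identityʳ (suc A))
      (ℕ.^-monoʳ-≤ (suc A) (ℕ.>-nonZero⁻¹ q))))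
  where
  A = a ℕ.* suc k ^ q

^-distribʳ-* : ∀ q m n → (m ℕ.* n) ^ q ≡ m ^ q ℕ.* n ^ q
^-distribʳ-* zero    m n = refl
^-distribʳ-* (suc q) m n rewrite ^-distribʳ-* q m n =
  ℕ.[m*n]*[o*p]≡[m*o]*[n*p] m n (m ^ q) (n ^ q)

^-cancelˡ-< : ∀ q m n → m ^ q ℕ.< n ^ q → m ℕ.< n
^-cancelˡ-< q m n lt with m ℕ.<? n
... | yes m<n = m<n
... | no  m≮n = contradiction lt (ℕ.≤⇒≯ (ℕ.^-monoˡ-≤ q (ℕ.≮⇒≥ m≮n)))

rootNum-cross : ∀ q .{{_ : ℕ.NonZero q}} a k l →
                rootNum q a k ℕ.* suc l ℕ.< suc (rootNum q a l) ℕ.* suc k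
rootNum-cross q a k l = ^-cancelˡ-< q _ _ (begin-strict
  (rootNum q a k ℕ.* suc l) ^ q
    ≡⟨ ^-distribʳ-* q (rootNum q a k) (suc l) ⟩
  rootNum q a k ^ q ℕ.* suc l ^ q
    ≤⟨ ℕ.*-monoˡ-≤ (suc l ^ q) (rootNum-lower q a k) ⟩
  a ℕ.* suc k ^ q ℕ.* suc l ^ q
    ≡⟨ ℕ.*-assoc a (suc k ^ q) (suc l ^ q) ⟩
  a ℕ.* (suc k ^ q ℕ.* suc l ^ q)
    ≡⟨ cong (a ℕ.*_) (ℕ.*-comm (suc k ^ q) (suc l ^ q)) ⟩
  a ℕ.* (suc l ^ q ℕ.* suc k ^ q)
    ≡⟨ ℕ.*-assoc a (suc l ^ q) (suc k ^ q) ⟨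
  a ℕ.* suc l ^ q ℕ.* suc k ^ q
    <⟨ ℕ.*-monoˡ-< (suc k ^ q) {{ℕ.m^n≢0 (suc k) q}} (rootNum-upper q a l) ⟩
  suc (rootNum q a l) ^ q ℕ.* suc k ^ q
    ≡⟨ ^-distribʳ-* q (suc (rootNum q a l)) (suc k) ⟨
  (suc (rootNum q a l) ℕ.* suc k) ^ q ∎)
  where open ℕ.≤-Reasoning

/-mono-< : ∀ a b m n → a ℕ.* suc n ℕ.< b ℕ.* suc m →
           + a / suc m ℚ.< + b / suc n
/-mono-< a b m n lt = ℚ.toℚᵘ-cancel-< (begin-strict
  ℚ.toℚᵘ (+ a / suc m)  ≃⟨ ℚ.toℚᵘ-fromℚᵘ (ℚᵘ.mkℚᵘ (+ a) m) ⟩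
  ℚᵘ.mkℚᵘ (+ a) m       <⟨ ℚᵘ.*<* (subst₂ ℤ._<_ (ℤ.pos-* a (suc n))
                                      (ℤ.pos-* b (suc m)) (ℤ.+<+ lt)) ⟩
  ℚᵘ.mkℚᵘ (+ b) n       ≃⟨ ℚ.toℚᵘ-fromℚᵘ (ℚᵘ.mkℚᵘ (+ b) n) ⟨
  ℚ.toℚᵘ (+ b / suc n)  ∎)
  where open ℚᵘ.≤-Reasoning

suc-/ : ∀ b n → + suc b / suc n ≡ + 1 / suc n ℚ.+ + b / suc n
suc-/ b n = ℚ.toℚᵘ-injective (begin
  ℚ.toℚᵘ (+ suc b / suc n)
    ≈⟨ ℚ.toℚᵘ-fromℚᵘ (ℚᵘ.mkℚᵘ (+ suc b) n) ⟩
  ℚᵘ.mkℚᵘ (+ suc b) n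
    ≈⟨ ℚᵘ.*≡* (cross (+ b) (+ suc n)) ⟩
  ℚᵘ.mkℚᵘ (+ 1) n ℚᵘ.+ ℚᵘ.mkℚᵘ (+ b) n
    ≈⟨ ℚᵘ.+-cong (ℚ.toℚᵘ-fromℚᵘ (ℚᵘ.mkℚᵘ (+ 1) n))
                 (ℚ.toℚᵘ-fromℚᵘ (ℚᵘ.mkℚᵘ (+ b) n)) ⟨
  ℚ.toℚᵘ (+ 1 / suc n) ℚᵘ.+ ℚ.toℚᵘ (+ b / suc n)
    ≈⟨ ℚ.toℚᵘ-homo-+ (+ 1 / suc n) (+ b / suc n) ⟨
  ℚ.toℚᵘ (+ 1 / suc n ℚ.+ + b / suc n) ∎)
  where
  open ℚᵘ.≃-Reasoning
  cross : ∀ x y → (+ 1 ℤ.+ x) ℤ.* (y ℤ.* y) ≡ (+ 1 ℤ.* y ℤ.+ x ℤ.* y) ℤ.* y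
  cross = solve 2 (λ x y → (con (+ 1) :+ x) :* (y :* y) :=
                           (con (+ 1) :* y :+ x :* y) :* y) refl
    where open ℤ-Solver.+-*-Solver

archimedean : ∀ ε → 0ℚ ℚ.< ε → ∃ λ N → ∀ {k} → N ℕ.≤ k → + 1 / suc k ℚ.< ε
archimedean (mkℚ (+ zero) d c) (ℚ.*<* (ℤ.+<+ ()))
archimedean ε@(mkℚ (+ suc a) d c) _ = suc d , λ {k} N≤k →
  ℚ.toℚᵘ-cancel-< (ℚᵘ.<-respˡ-≃ (ℚᵘ.≃-sym (ℚ.toℚᵘ-fromℚᵘ (ℚᵘ.mkℚᵘ (+ 1) k)))
    (ℚᵘ.*<* (subst₂ ℤ._<_ (ℤ.pos-* 1 (suc d)) (ℤ.pos-* (suc a) (suc k))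
      (ℤ.+<+ (begin-strict
        1 ℕ.* suc d      ≡⟨ ℕ.*-identityˡ (suc d) ⟩
        suc d            <⟨ ℕ.s≤s N≤k ⟩
        suc k            ≤⟨ ℕ.m≤n*m (suc k) (suc a) ⟩
        suc a ℕ.* suc k  ∎)))))
  where open ℕ.≤-Reasoning
archimedean (mkℚ (ℤ.-[1+ a ]) d c) (ℚ.*<* ())

rootSeq-< : ∀ q .{{_ : ℕ.NonZero q}} a k l →
            rootSeq q a k ℚ.- rootSeq q a l ℚ.< + 1 / suc l
rootSeq-< q a k l = begin-strict
  rootSeq q a k ℚ.- y
    <⟨ ℚ.+-monoˡ-< (ℚ.- y)
         (/-mono-< (rootNum q a k) (suc (rootNum q a l)) k l (rootNum-cross q a k l)) ⟩
  + suc (rootNum q a l) / suc l ℚ.- y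
    ≡⟨ cong (ℚ._- y) (suc-/ (rootNum q a l) l) ⟩
  + 1 / suc l ℚ.+ y ℚ.- y
    ≡⟨ +-*-Solver.solve 2 (λ e y → let open +-*-Solver in
         e :+ y :- y := e) refl (+ 1 / suc l) y ⟩
  + 1 / suc l ∎
  where
  open ℚ.≤-Reasoning
  y = rootSeq q a l

∣-∣-< : ∀ p q {ε} → p ℚ.- q ℚ.< ε → q ℚ.- p ℚ.< ε → ∣ p ℚ.- q ∣ ℚ.< ε
∣-∣-< p q {ε} h h′ with ℚ.∣p∣≡p∨∣p∣≡-p (p ℚ.- q)
... | inj₁ e = subst (ℚ._< ε) (sym e) h
... | inj₂ e = subst (ℚ._< ε) (sym (trans e
      (+-*-Solver.solve 2 (λ p q → let open +-*-Solver in
         :- (p :- q) := q :- p) refl p q))) h′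

rootSeq-cauchy : ∀ q .{{_ : ℕ.NonZero q}} a → IsCauchy (rootSeq q a)
rootSeq-cauchy q a ε ε>0 =
  let N , h = archimedean ε ε>0
  in N , λ {m} {n} N≤m N≤n →
    ∣-∣-< (rootSeq q a m) (rootSeq q a n)
      (ℚ.<-trans (rootSeq-< q a m n) (h N≤n))
      (ℚ.<-trans (rootSeq-< q a n m) (h N≤m))

root : ∀ q .{{_ : ℕ.NonZero q}} → ℕ → ℝ
root q a = mkℝ (rootSeq q a) (rootSeq-cauchy q a)

-- n ^ (p/q); in particular n ^ (d - 1/d) is pow n (d * d ∸ 1) d.
pow : ℕ → ℕ → ∀ q .{{_ : ℕ.NonZero q}} → ℝ
pow n p q = root q (n ^ p)

------------------------------------------------------------------------
-- Cubes, configurations and visibility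

Point : ℕ → Set
Point d = Fin d → ℝ

-- The entries are the coordinates of the corner closest to the origin.
Cube : ℕ → ℕ → Set
Cube d n = Vec (Fin n) d

corner : ∀ {d n} → Cube d n → Fin d → ℕ
corner Q i = toℕ (lookup Q i)

-- p lies in the closed unit cube ∏ᵢ [aᵢ , aᵢ + 1].
InUnitCube : ∀ {d} → (Fin d → ℕ) → Point d → Set
InUnitCube a p = ∀ i → fromℕ (a i) ≤ᵣ p i × p i ≤ᵣ fromℕ (suc (a i))

_∈ᶜ_ : ∀ {d n} → Point d → Cube d n → Set
p ∈ᶜ Q = InUnitCube (corner Q) p

InObserver : ∀ {d} → Point d → Set
InObserver = InUnitCube (λ _ → 0)

IsObserver : ∀ {d n} → Cube d n → Set
IsObserver Q = ∀ i → corner Q i ≡ 0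

-- Multiplicities and order in the list carry no meaning.
record Configuration (d n : ℕ) : Set where
  field
    obstructing  : List (Cube d n)
    not-observer : ∀ {Q} → Q ∈ obstructing → ¬ IsObserver Q

open Configuration public

segment : ∀ {d} → Point d → Point d → ℝ → Point d
segment x y t i = (fromℕ 1 -ᵣ t) *ᵣ x i +ᵣ t *ᵣ y i

SegmentMeets : ∀ {d n} → Point d → Point d → Cube d n → Set
SegmentMeets x y Q =
  ∃ λ t → fromℕ 0 ≤ᵣ t × t ≤ᵣ fromℕ 1 × segment x y t ∈ᶜ Q

record Visible {d n} (O : Configuration d n) (Q : Cube d n) : Set where
  field
    is-obstructing : Q ∈ obstructing O
    from to        : Point d
    from∈observer  : InObserver from
    to∈Q           : to ∈ᶜ Q
    unobstructed   : ∀ {Q′} → Q′ ∈ obstructing O → Q′ ≢ Q →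
                     ¬ SegmentMeets from to Q′

-- Exactly m cubes of O are visible.
NumberVisible : ∀ {d n} → Configuration d n → ℕ → Set
NumberVisible {d} {n} O m =
  Σ (List (Cube d n)) λ L →
    Unique L × (∀ Q → Q ∈ L ⇔ Visible O Q) × length L ≡ m

{-# OPTIONS --safe #-}
-- The cubes are placed in disjoint tubes around rays of directions p spaced by a constant.  By
-- Dirichlet's theorem each p is almost orthogonal to an integer vector v with entries of size
-- N ≈ n^(1/d): v ∙ p = O(N), so v ∙ a = O(N) for the Θ(n) cells a along the ray, and by pigeonhole
-- Ω(n / N) of these cells lie on a common level v ∙ a = c.  These are the obstructing cubes of the
-- tube.  Choosing the sign of v such that c < 0, the cube at a is seen along the segment from the
-- corner x of the observer that maximises v to x + a: on this segment v decreases from v ∙ x to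
-- v ∙ x + c, which is the maximum of v on every cube of the tube.  So a tube contributes
-- Ω(n^(1 - 1/d)) visible cubes, and there are Ω(n^(d-1)) tubes.
module Submission where

open import Defs
open import Algebra.Bundles using (CommutativeRing)
open import Data.Fin.Base as Fin using (Fin; zero; suc; toℕ; fromℕ<; finToFun; funToFin)
import Data.Fin.Properties as Fin
open import Data.Integer.Base as ℤ using (ℤ; +_; -[1+_])
import Data.Integer.Properties as ℤ
open import Data.Integer.Tactic.RingSolver using () renaming (solve-∀ to ℤ-solve-∀)
open import Data.List.Base as List using (List; []; _∷_; length; filter; concat; allFin)
open import Data.List.Membership.Propositional using (_∈_)
open import Data.List.Membership.Propositional.Properties using (∈-concat⁻′; ∈-filter⁻; ∈-map⁻; ∈-tabulate⁻)
import Data.List.Properties as List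
open import Data.List.Relation.Binary.Disjoint.Propositional using (Disjoint)
import Data.List.Relation.Unary.All as All
import Data.List.Relation.Unary.All.Properties as All
import Data.List.Relation.Unary.AllPairs.Properties as AllPairs
open import Data.List.Relation.Unary.Unique.Propositional using (Unique)
import Data.List.Relation.Unary.Unique.Propositional.Properties as Unique
open import Data.Nat.Base as ℕ using (ℕ; zero; suc; _^_; _∸_; _>_; >-nonZero)
import Data.Nat.DivMod as ℕ
import Data.Nat.Properties as ℕ
open import Data.Nat.Properties using (m<n⇒0<n)
open import Data.Nat.Tactic.RingSolver using () renaming (solve-∀ to ℕ-solve-∀)
open import Data.Product.Base using (Σ; ∃; ∃₂; _×_; _,_; proj₁; proj₂)
open import Data.Rational.Base as ℚ using (ℚ; 0ℚ; 1ℚ; ½; _/_; ∣_∣; _≤_; _+_; _*_; _-_; -_)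
import Data.Rational.Properties as ℚ
open import Data.Rational.Solver using (module +-*-Solver)
import Data.Rational.Unnormalised.Base as ℚᵘ
import Data.Rational.Unnormalised.Properties as ℚᵘ
open import Data.Sum.Base using (_⊎_; inj₁; inj₂)
import Data.Vec.Base as Vec
import Data.Vec.Properties as Vec
open import Function.Base using (_∘_)
open import Function.Bundles using (mk⇔)
open import Relation.Binary.Definitions using (tri<; tri≈; tri>)
open import Relation.Binary.PropositionalEquality
open import Relation.Nullary.Decidable using (yes; no)
open import Relation.Nullary.Negation using (¬_; contradiction)
open import Relation.Unary using (Decidable)

open +-*-Solver using (solve; _:=_; _:+_; _:*_; _:-_; :-_; con)
open import Algebra.Properties.Semiring.Sum ℕ.+-*-semiring using ()
  renaming (sum to sumℕ)
open import Algebra.Properties.Semiring.Sum ℤ.+-*-semiring using ()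
  renaming (sum to sumℤ; sum-cong-≋ to sumℤ-cong; ∑-distrib-+ to sumℤ-+; *-distribˡ-sum to sumℤ-*)
open import Algebra.Properties.Semiring.Sum (CommutativeRing.semiring ℚ.+-*-commutativeRing) using ()
  renaming (sum to sumℚ; sum-cong-≋ to sumℚ-cong; ∑-distrib-+ to sumℚ-+; *-distribˡ-sum to sumℚ-*)

-- Integers inside the rationals, and absolute values

ι : ℤ → ℚ
ι z = z / 1

ι-toℚᵘ : ∀ z → ℚ.toℚᵘ (ι z) ℚᵘ.≃ ℚᵘ.mkℚᵘ z 0
ι-toℚᵘ z = ℚ.toℚᵘ-fromℚᵘ (ℚᵘ.mkℚᵘ z 0)

ι-+ : ∀ x y → ι (x ℤ.+ y) ≡ ι x + ι y
ι-+ x y = ℚ.toℚᵘ-injective (begin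
  ℚ.toℚᵘ (ι (x ℤ.+ y))                ≈⟨ ι-toℚᵘ (x ℤ.+ y) ⟩
  ℚᵘ.mkℚᵘ (x ℤ.+ y) 0                 ≈⟨ ℚᵘ.*≡* (cross x y) ⟩
  ℚᵘ.mkℚᵘ x 0 ℚᵘ.+ ℚᵘ.mkℚᵘ y 0        ≈⟨ ℚᵘ.+-cong (ι-toℚᵘ x) (ι-toℚᵘ y) ⟨
  ℚ.toℚᵘ (ι x) ℚᵘ.+ ℚ.toℚᵘ (ι y)      ≈⟨ ℚ.toℚᵘ-homo-+ (ι x) (ι y) ⟨
  ℚ.toℚᵘ (ι x + ι y)                  ∎)
  where
  open ℚᵘ.≃-Reasoning
  cross : ∀ x y → (x ℤ.+ y) ℤ.* + 1 ≡ (x ℤ.* + 1 ℤ.+ y ℤ.* + 1) ℤ.* + 1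
  cross = ℤ-solve-∀

ι-* : ∀ x y → ι (x ℤ.* y) ≡ ι x * ι y
ι-* x y = ℚ.toℚᵘ-injective (begin
  ℚ.toℚᵘ (ι (x ℤ.* y))                ≈⟨ ι-toℚᵘ (x ℤ.* y) ⟩
  ℚᵘ.mkℚᵘ x 0 ℚᵘ.* ℚᵘ.mkℚᵘ y 0        ≈⟨ ℚᵘ.*-cong (ι-toℚᵘ x) (ι-toℚᵘ y) ⟨
  ℚ.toℚᵘ (ι x) ℚᵘ.* ℚ.toℚᵘ (ι y)      ≈⟨ ℚ.toℚᵘ-homo-* (ι x) (ι y) ⟨
  ℚ.toℚᵘ (ι x * ι y)                  ∎)
  where open ℚᵘ.≃-Reasoning

ι-neg : ∀ x → ι (ℤ.- x) ≡ - ι x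
ι-neg x = ℚ.toℚᵘ-injective (begin
  ℚ.toℚᵘ (ι (ℤ.- x))                  ≈⟨ ι-toℚᵘ (ℤ.- x) ⟩
  ℚᵘ.- ℚᵘ.mkℚᵘ x 0                    ≈⟨ ℚᵘ.-‿cong (ι-toℚᵘ x) ⟨
  ℚᵘ.- ℚ.toℚᵘ (ι x)                   ≈⟨ ℚ.toℚᵘ-homo‿- (ι x) ⟨
  ℚ.toℚᵘ (- ι x)                      ∎)
  where open ℚᵘ.≃-Reasoning

ι-mono-≤ : ∀ {x y} → x ℤ.≤ y → ι x ≤ ι y
ι-mono-≤ {x} {y} x≤y = ℚ.toℚᵘ-cancel-≤ (begin
  ℚ.toℚᵘ (ι x)  ≃⟨ ι-toℚᵘ x ⟩
  ℚᵘ.mkℚᵘ x 0   ≤⟨ ℚᵘ.*≤* (ℤ.*-monoʳ-≤-nonNeg (+ 1) x≤y) ⟩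
  ℚᵘ.mkℚᵘ y 0   ≃⟨ ι-toℚᵘ y ⟨
  ℚ.toℚᵘ (ι y)  ∎)
  where open ℚᵘ.≤-Reasoning


ι-cancel-≤ : ∀ {x y} → ι x ≤ ι y → x ℤ.≤ y
ι-cancel-≤ {x} {y} ιx≤ιy = subst₂ ℤ._≤_ (ℤ.*-identityʳ x) (ℤ.*-identityʳ y)
  (ℚᵘ.drop-*≤* (begin
    ℚᵘ.mkℚᵘ x 0   ≃⟨ ι-toℚᵘ x ⟨
    ℚ.toℚᵘ (ι x)  ≤⟨ ℚ.toℚᵘ-mono-≤ ιx≤ιy ⟩
    ℚ.toℚᵘ (ι y)  ≃⟨ ι-toℚᵘ y ⟩
    ℚᵘ.mkℚᵘ y 0   ∎))
  where open ℚᵘ.≤-Reasoning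

⟦_⟧ : ℕ → ℚ
⟦ n ⟧ = ι (+ n)

⟦⟧-+ : ∀ m n → ⟦ m ℕ.+ n ⟧ ≡ ⟦ m ⟧ + ⟦ n ⟧
⟦⟧-+ m n = ι-+ (+ m) (+ n)

⟦⟧-* : ∀ m n → ⟦ m ℕ.* n ⟧ ≡ ⟦ m ⟧ * ⟦ n ⟧
⟦⟧-* m n = trans (cong ι (ℤ.pos-* m n)) (ι-* (+ m) (+ n))

⟦⟧-mono-≤ : ∀ {m n} → m ℕ.≤ n → ⟦ m ⟧ ≤ ⟦ n ⟧
⟦⟧-mono-≤ m≤n = ι-mono-≤ (ℤ.+≤+ m≤n)

⟦⟧-cancel-≤ : ∀ {m n} → ⟦ m ⟧ ≤ ⟦ n ⟧ → m ℕ.≤ n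
⟦⟧-cancel-≤ le = ℤ.drop‿+≤+ (ι-cancel-≤ le)

0≤⟦_⟧ : ∀ n → 0ℚ ≤ ⟦ n ⟧
0≤⟦ n ⟧ = ⟦⟧-mono-≤ {0} {n} ℕ.z≤n

⟦⟧-nonNeg : ∀ n → ℚ.NonNegative ⟦ n ⟧
⟦⟧-nonNeg n = ℚ.nonNegative 0≤⟦ n ⟧

*-mono-≤-0≤ : ∀ {p q r s} → 0ℚ ≤ p → p ≤ q → 0ℚ ≤ r → r ≤ s → p * r ≤ q * s
*-mono-≤-0≤ {p} {q} {r} {s} 0≤p p≤q 0≤r r≤s = ℚ.≤-trans
  (ℚ.*-monoʳ-≤-nonNeg r {{ℚ.nonNegative 0≤r}} p≤q)
  (ℚ.*-monoˡ-≤-nonNeg q {{ℚ.nonNegative (ℚ.≤-trans 0≤p p≤q)}} r≤s)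

∣-∣-≤ : ∀ p {b} → p ≤ b → - p ≤ b → ∣ p ∣ ≤ b
∣-∣-≤ p {b} p≤b -p≤b with ℚ.∣p∣≡p∨∣p∣≡-p p
... | inj₁ e = subst (_≤ b) (sym e) p≤b
... | inj₂ e = subst (_≤ b) (sym e) -p≤b

p≤∣p∣ : ∀ p → p ≤ ∣ p ∣
p≤∣p∣ p with ℚ.≤-total 0ℚ p
... | inj₁ 0≤p = ℚ.≤-reflexive (sym (ℚ.0≤p⇒∣p∣≡p 0≤p))
... | inj₂ p≤0 = ℚ.≤-trans p≤0 (ℚ.0≤∣p∣ p)

∣*∣-≤ : ∀ p q {b c} → ∣ p ∣ ≤ b → ∣ q ∣ ≤ c → ∣ p * q ∣ ≤ b * c
∣*∣-≤ p q p≤b q≤c = subst (_≤ _) (sym (ℚ.∣p*q∣≡∣p∣*∣q∣ p q))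
  (*-mono-≤-0≤ (ℚ.0≤∣p∣ p) p≤b (ℚ.0≤∣p∣ q) q≤c)

∣+∣-≤ : ∀ p q {b c} → ∣ p ∣ ≤ b → ∣ q ∣ ≤ c → ∣ p + q ∣ ≤ b + c
∣+∣-≤ p q p≤b q≤c = ℚ.≤-trans (ℚ.∣p+q∣≤∣p∣+∣q∣ p q) (ℚ.+-mono-≤ p≤b q≤c)

p≤q+r⇒p-q≤r : ∀ p q r → p ≤ q + r → p - q ≤ r
p≤q+r⇒p-q≤r p q r le = subst (p - q ≤_)
  (solve 2 (λ q r → q :+ r :- q := r) refl q r) (ℚ.+-monoˡ-≤ (- q) le)

p-q≤r⇒p≤q+r : ∀ p q r → p - q ≤ r → p ≤ q + r
p-q≤r⇒p≤q+r p q r le = subst (_≤ q + r)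
  (solve 2 (λ p q → q :+ (p :- q) := p) refl p q) (ℚ.+-monoʳ-≤ q le)

∣-∣-sym : ∀ p q → ∣ p - q ∣ ≡ ∣ q - p ∣
∣-∣-sym p q = trans (sym (ℚ.∣-p∣≡∣p∣ (p - q)))
  (cong ∣_∣ (solve 2 (λ p q → :- (p :- q) := q :- p) refl p q))

∣⟦⟧-⟦⟧∣-≤ : ∀ {m k b} → m ℕ.≤ k ℕ.+ b → k ℕ.≤ m ℕ.+ b → ∣ ⟦ m ⟧ - ⟦ k ⟧ ∣ ≤ ⟦ b ⟧
∣⟦⟧-⟦⟧∣-≤ {m} {k} {b} m≤ k≤ = ∣-∣-≤ _
  (p≤q+r⇒p-q≤r ⟦ m ⟧ ⟦ k ⟧ ⟦ b ⟧ (subst (⟦ m ⟧ ≤_) (⟦⟧-+ k b) (⟦⟧-mono-≤ m≤)))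
  (subst (_≤ ⟦ b ⟧) (solve 2 (λ p q → q :- p := :- (p :- q)) refl ⟦ m ⟧ ⟦ k ⟧)
    (p≤q+r⇒p-q≤r ⟦ k ⟧ ⟦ m ⟧ ⟦ b ⟧ (subst (⟦ k ⟧ ≤_) (⟦⟧-+ m b) (⟦⟧-mono-≤ k≤))))

∣⟦⟧-⟦⟧∣-≤⁻¹ : ∀ {m k b} → ∣ ⟦ m ⟧ - ⟦ k ⟧ ∣ ≤ ⟦ b ⟧ → m ℕ.≤ k ℕ.+ b
∣⟦⟧-⟦⟧∣-≤⁻¹ {m} {k} {b} le = ⟦⟧-cancel-≤ (subst (⟦ m ⟧ ≤_) (sym (⟦⟧-+ k b))
  (p-q≤r⇒p≤q+r ⟦ m ⟧ ⟦ k ⟧ ⟦ b ⟧ (ℚ.≤-trans (p≤∣p∣ _) le)))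

-- Sight lines and the rays of direction p

-- Here x = s p, so that a is within distance 1 of the point s p / n of the ray.
record NearRay (n x a : ℕ) : Set where
  constructor near-ray
  field
    below : n ℕ.* a ℕ.≤ x ℕ.+ n
    above : x ℕ.≤ n ℕ.* a ℕ.+ n

-- Besides `n * (τ * a - a′)`, which is at most `2 n`, the error is `τ` times the rounding error of
-- `x` plus that of `x′`, at most `2 n + n`.
near-ray-scaled : ∀ {n x x′ a a′} τ → NearRay n x a → NearRay n x′ a′ →
                  ∣ τ ∣ ≤ ⟦ 2 ⟧ → ∣ τ * ⟦ a ⟧ - ⟦ a′ ⟧ ∣ ≤ ⟦ 2 ⟧ →
                  ∣ τ * ⟦ x ⟧ - ⟦ x′ ⟧ ∣ ≤ ⟦ 5 ℕ.* n ⟧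
near-ray-scaled {n} {x} {x′} {a} {a′} τ (near-ray b c) (near-ray b′ c′) τ≤2 diff≤2 =
  subst₂ _≤_
    (cong ∣_∣ (solve 6 (λ n x x′ a a′ τ →
      n :* (τ :* a :- a′) :+ (τ :* (x :- n :* a) :+ (n :* a′ :- x′)) := τ :* x :- x′)
      refl ⟦ n ⟧ ⟦ x ⟧ ⟦ x′ ⟧ ⟦ a ⟧ ⟦ a′ ⟧ τ))
    (trans (solve 1 (λ n → n :* con ⟦ 2 ⟧ :+ (con ⟦ 2 ⟧ :* n :+ n) := con ⟦ 5 ⟧ :* n) refl ⟦ n ⟧)
           (sym (⟦⟧-* 5 n)))
    (∣+∣-≤ _ _ (∣*∣-≤ ⟦ n ⟧ _ (ℚ.≤-reflexive (ℚ.0≤p⇒∣p∣≡p 0≤⟦ n ⟧)) diff≤2)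
      (∣+∣-≤ _ _
        (∣*∣-≤ τ _ τ≤2 (subst (λ z → ∣ ⟦ x ⟧ - z ∣ ≤ ⟦ n ⟧) (⟦⟧-* n a) (∣⟦⟧-⟦⟧∣-≤ c b)))
        (subst (λ z → ∣ z - ⟦ x′ ⟧ ∣ ≤ ⟦ n ⟧) (⟦⟧-* n a′) (∣⟦⟧-⟦⟧∣-≤ b′ c′))))

-- Comparing the coordinate in direction p with the one in direction n eliminates τ.
near-rays-≤ : ∀ {n s s′ p p′ a a′ a₀ a₀′} τ → ℕ.NonZero n →
  NearRay n (s ℕ.* p) a → NearRay n (s′ ℕ.* p′) a′ →
  NearRay n (s ℕ.* n) a₀ → NearRay n (s′ ℕ.* n) a₀′ →
  p ℕ.≤ n → ∣ τ ∣ ≤ ⟦ 2 ⟧ →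
  ∣ τ * ⟦ a ⟧ - ⟦ a′ ⟧ ∣ ≤ ⟦ 2 ⟧ → ∣ τ * ⟦ a₀ ⟧ - ⟦ a₀′ ⟧ ∣ ≤ ⟦ 2 ⟧ →
  ∣ ⟦ s′ ℕ.* p ⟧ - ⟦ s′ ℕ.* p′ ⟧ ∣ ≤ ⟦ 10 ℕ.* n ⟧
near-rays-≤ {n} {s} {s′} {p} {p′} τ n≢0 r r′ r₀ r₀′ p≤n τ≤2 d d₀ =
  -- Multiplied by `n`, the difference is `n (τ s p - s′ p′) - p (τ s n - s′ n)`. By
  -- `near-ray-scaled` each bracket is at most `5 n`, and `p ≤ n`.
  ℚ.*-cancelˡ-≤-pos ⟦ n ⟧ {{pos}} (subst₂ _≤_
    (trans (cong ∣_∣ (trans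
      (cong₂ _+_
        (cong (⟦ n ⟧ *_) (cong₂ (λ y z → τ * y - z) (⟦⟧-* s p) (⟦⟧-* s′ p′)))
        (cong (- ⟦ p ⟧ *_) (cong₂ (λ y z → τ * y - z) (⟦⟧-* s n) (⟦⟧-* s′ n))))
      (trans (solve 6 (λ n s s′ p p′ τ →
        n :* (τ :* (s :* p) :- s′ :* p′) :+ (:- p) :* (τ :* (s :* n) :- s′ :* n)
          := n :* (s′ :* p :- s′ :* p′)) refl ⟦ n ⟧ ⟦ s ⟧ ⟦ s′ ⟧ ⟦ p ⟧ ⟦ p′ ⟧ τ)
        (cong (⟦ n ⟧ *_) (cong₂ _-_ (sym (⟦⟧-* s′ p)) (sym (⟦⟧-* s′ p′)))))))
      (trans (ℚ.∣p*q∣≡∣p∣*∣q∣ ⟦ n ⟧ _) (cong (_* ∣ ⟦ s′ ℕ.* p ⟧ - ⟦ s′ ℕ.* p′ ⟧ ∣) (∣⟦ n ⟧∣))))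
    (trans (cong (λ z → ⟦ n ⟧ * z + ⟦ n ⟧ * z) (⟦⟧-* 5 n))
      (trans (solve 1 (λ n → n :* (con ⟦ 5 ⟧ :* n) :+ n :* (con ⟦ 5 ⟧ :* n)
                := n :* (con ⟦ 10 ⟧ :* n)) refl ⟦ n ⟧)
             (cong (⟦ n ⟧ *_) (sym (⟦⟧-* 10 n)))))
    (∣+∣-≤ (⟦ n ⟧ * _) (- ⟦ p ⟧ * _)
      (∣*∣-≤ ⟦ n ⟧ _ (ℚ.≤-reflexive ∣⟦ n ⟧∣) (near-ray-scaled τ r r′ τ≤2 d))
      (∣*∣-≤ (- ⟦ p ⟧) _
        (ℚ.≤-trans (ℚ.≤-reflexive (trans (ℚ.∣-p∣≡∣p∣ ⟦ p ⟧) ∣⟦ p ⟧∣)) (⟦⟧-mono-≤ p≤n))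
        (near-ray-scaled τ r₀ r₀′ τ≤2 d₀))))
  where
  ∣⟦_⟧∣ : ∀ m → ∣ ⟦ m ⟧ ∣ ≡ ⟦ m ⟧
  ∣⟦ m ⟧∣ = ℚ.0≤p⇒∣p∣≡p 0≤⟦ m ⟧
  pos : ℚ.Positive ⟦ n ⟧
  pos = ℚ.normalize-pos n 1 {{_}} {{n≢0}}

-- Unequal `q` and `q′` would make `s′ g q` and `s′ g q′` differ by at least `g s′ > 20 s′ ≥ 10 n`,
-- against `near-rays-≤`. This is what the depth of at least `n / 2` and the spacing `g > 20` are
-- for.
near-rays-≡ : ∀ {n s s′ g q q′ a a′ a₀ a₀′} τ → ℕ.NonZero n → n ℕ.≤ 2 ℕ.* s′ → 20 ℕ.< g →
  NearRay n (s ℕ.* (g ℕ.* q)) a → NearRay n (s′ ℕ.* (g ℕ.* q′)) a′ →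
  NearRay n (s ℕ.* n) a₀ → NearRay n (s′ ℕ.* n) a₀′ →
  g ℕ.* q ℕ.≤ n → ∣ τ ∣ ≤ ⟦ 2 ⟧ →
  ∣ τ * ⟦ a ⟧ - ⟦ a′ ⟧ ∣ ≤ ⟦ 2 ⟧ → ∣ τ * ⟦ a₀ ⟧ - ⟦ a₀′ ⟧ ∣ ≤ ⟦ 2 ⟧ →
  q ≡ q′
near-rays-≡ {n} {s} {s′} {g} {q} {q′} τ n≢0 n≤2s′ 20<g r r′ r₀ r₀′ q≤n τ≤2 d d₀ =
  ℕ.≤-antisym (q≤ q q′ le) (q≤ q′ q (subst (_≤ ⟦ 10 ℕ.* n ⟧)
    (∣-∣-sym ⟦ s′ ℕ.* (g ℕ.* q) ⟧ ⟦ s′ ℕ.* (g ℕ.* q′) ⟧) le))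
  where
  le = near-rays-≤ {s = s} {s′} {g ℕ.* q} {g ℕ.* q′} τ n≢0 r r′ r₀ r₀′ q≤n τ≤2 d d₀
  s′≢0 : ℕ.NonZero s′
  s′≢0 = ℕ.≢-nonZero λ { refl → ℕ.n≮0 (ℕ.≤-trans (ℕ.>-nonZero⁻¹ n {{n≢0}}) n≤2s′) }
  q≤ : ∀ x y → ∣ ⟦ s′ ℕ.* (g ℕ.* x) ⟧ - ⟦ s′ ℕ.* (g ℕ.* y) ⟧ ∣ ≤ ⟦ 10 ℕ.* n ⟧ → x ℕ.≤ y
  q≤ x y h with x ℕ.≤? y
  ... | yes x≤y = x≤y
  ... | no  x≰y = contradiction (begin-strict
      s′ ℕ.* (g ℕ.* suc y)                    ≤⟨ ℕ.*-monoʳ-≤ s′ (ℕ.*-monoʳ-≤ g (ℕ.≰⇒> x≰y)) ⟩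
      s′ ℕ.* (g ℕ.* x)                        ≤⟨ ∣⟦⟧-⟦⟧∣-≤⁻¹ {s′ ℕ.* (g ℕ.* x)} {s′ ℕ.* (g ℕ.* y)} {10 ℕ.* n} h ⟩
      s′ ℕ.* (g ℕ.* y) ℕ.+ 10 ℕ.* n           ≤⟨ ℕ.+-monoʳ-≤ (s′ ℕ.* (g ℕ.* y)) (ℕ.*-monoʳ-≤ 10 n≤2s′) ⟩
      s′ ℕ.* (g ℕ.* y) ℕ.+ 10 ℕ.* (2 ℕ.* s′)  ≡⟨ cong (s′ ℕ.* (g ℕ.* y) ℕ.+_) (ℕ.*-assoc 10 2 s′) ⟨
      s′ ℕ.* (g ℕ.* y) ℕ.+ 20 ℕ.* s′          <⟨ ℕ.+-monoʳ-< (s′ ℕ.* (g ℕ.* y)) (ℕ.*-monoˡ-< s′ {{s′≢0}} 20<g) ⟩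
      s′ ℕ.* (g ℕ.* y) ℕ.+ g ℕ.* s′           ≡⟨ factor s′ g y ⟩
      s′ ℕ.* (g ℕ.* suc y)                    ∎) (ℕ.<-irrefl refl)
    where
    open ℕ.≤-Reasoning
    factor : ∀ s g y → s ℕ.* (g ℕ.* y) ℕ.+ g ℕ.* s ≡ s ℕ.* (g ℕ.* suc y)
    factor = ℕ-solve-∀

-- Heights along a sight line

sumℚ-mono-≤ : ∀ {d} {f g : Fin d → ℚ} → (∀ i → f i ≤ g i) → sumℚ f ≤ sumℚ g
sumℚ-mono-≤ {zero}  f≤g = ℚ.≤-refl
sumℚ-mono-≤ {suc d} f≤g = ℚ.+-mono-≤ (f≤g zero) (sumℚ-mono-≤ (f≤g ∘ suc))

ι-sum : ∀ {d} (f : Fin d → ℤ) → ι (sumℤ f) ≡ sumℚ (ι ∘ f)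
ι-sum {zero}  f = refl
ι-sum {suc d} f = trans (ι-+ (f zero) (sumℤ (f ∘ suc))) (cong (λ s → ι (f zero) + s) (ι-sum (f ∘ suc)))

⟦⟧-sum : ∀ {d} (f : Fin d → ℕ) → ⟦ sumℕ f ⟧ ≡ sumℚ (⟦_⟧ ∘ f)
⟦⟧-sum {zero}  f = refl
⟦⟧-sum {suc d} f = trans (⟦⟧-+ (f zero) (sumℕ (f ∘ suc))) (cong (λ s → ⟦ f zero ⟧ + s) (⟦⟧-sum (f ∘ suc)))

-- ∏ᵢ [0 , 1] maximises ∑ᵢ vᵢ xᵢ at x = topCorner ∘ v.
topCorner : ℤ → ℕ
topCorner (+ _)    = 1
topCorner -[1+ _ ] = 0

topCorner≤1 : ∀ v → topCorner v ℕ.≤ 1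
topCorner≤1 (+ _)    = ℕ.≤-refl
topCorner≤1 -[1+ _ ] = ℕ.z≤n

-- The product is largest at the end of `[- ε , 1 + ε]` selected by the sign of `v`, which lies `ε`
-- beyond `topCorner v`.
topCorner-max : ∀ v w ε → - ε ≤ w → w ≤ 1ℚ + ε →
                ι v * w ≤ ι v * ⟦ topCorner v ⟧ + ⟦ ℤ.∣ v ∣ ⟧ * ε
topCorner-max (+ m) w ε _ w≤1+ε = ℚ.≤-trans
  (ℚ.*-monoˡ-≤-nonNeg ⟦ m ⟧ {{⟦⟧-nonNeg m}} w≤1+ε)
  (ℚ.≤-reflexive (ℚ.*-distribˡ-+ ⟦ m ⟧ 1ℚ ε))
topCorner-max -[1+ m ] w ε -ε≤w _ = ℚ.≤-trans
  (ℚ.*-monoˡ-≤-nonPos (ι -[1+ m ]) {{ℚ.nonPositive (ι-mono-≤ { -[1+ m ]} {+ 0} ℤ.-≤+)}} -ε≤w)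
  (ℚ.≤-reflexive (trans
    (solve 2 (λ v ε → v :* (:- ε) := v :* con 0ℚ :+ (:- v) :* ε) refl (ι -[1+ m ]) ε)
    (cong (λ z → ι -[1+ m ] * 0ℚ + z * ε) (sym (ι-neg -[1+ m ])))))

p+q≤p+r⇒q≤r : ∀ p q r → p + q ≤ p + r → q ≤ r
p+q≤p+r⇒q≤r p q r le = subst₂ _≤_ (cancel q) (cancel r) (ℚ.+-monoʳ-≤ (- p) le)
  where
  cancel : ∀ x → - p + (p + x) ≡ x
  cancel x = solve 2 (λ p x → :- p :+ (p :+ x) := x) refl p x

-- The point of parameter τ on the segment from x to x + a lies in a′ + [0 , 1]ᵈ up to ε.  Real
-- inequalities only give such approximations, at a rational τ.
record Near {d} (x a a′ : Fin d → ℕ) (τ ε : ℚ) : Set where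
  field
    0≤τ+ε : 0ℚ ≤ τ + ε
    τ≤1+ε : τ ≤ 1ℚ + ε
    lower : ∀ i → ⟦ a′ i ⟧ ≤ (⟦ x i ⟧ + τ * ⟦ a i ⟧) + ε
    upper : ∀ i → ⟦ x i ⟧ + τ * ⟦ a i ⟧ ≤ (1ℚ + ⟦ a′ i ⟧) + ε

-- The linear form v attains its maximum over a′ + [0 , 1]ᵈ at the corner a′ + x, where it equals
-- its value at the end of the segment from x to a + x; before that end it is larger on the segment.
near-end : ∀ {d} (v : Fin d → ℤ) {a a′ : Fin d → ℕ} {c τ ε} → c ℤ.< + 0 →
           sumℤ (λ i → v i ℤ.* + a i) ≡ c → sumℤ (λ i → v i ℤ.* + a′ i) ≡ c →
           0ℚ ≤ ε → Near (topCorner ∘ v) a a′ τ ε →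
           1ℚ - τ ≤ ⟦ sumℕ (ℤ.∣_∣ ∘ v) ⟧ * ε
near-end {d} v {a} {a′} {c@(-[1+ k ])} {τ} {ε} _ va≡c va′≡c 0≤ε near
  with ℚ.≤-total (1ℚ - τ) 0ℚ
... | inj₁ 1-τ≤0 = ℚ.≤-trans 1-τ≤0
  (subst (_≤ V * ε) (ℚ.*-zeroʳ V) (ℚ.*-monoˡ-≤-nonNeg V {{⟦⟧-nonNeg (sumℕ (ℤ.∣_∣ ∘ v))}} 0≤ε))
  where V = ⟦ sumℕ (ℤ.∣_∣ ∘ v) ⟧
... | inj₂ 0≤1-τ = begin
  1ℚ - τ                       ≡⟨ ℚ.*-identityʳ (1ℚ - τ) ⟨
  -- A negative integer is at most `- 1`, so the drop `(1 - τ) * (- c)` of the form between `τ` and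
  -- the end is at least `1 - τ`.
  (1ℚ - τ) * ⟦ 1 ⟧             ≤⟨ ℚ.*-monoˡ-≤-nonNeg (1ℚ - τ) {{ℚ.nonNegative 0≤1-τ}}
                                    (⟦⟧-mono-≤ {1} {suc k} (ℕ.s≤s ℕ.z≤n)) ⟩
  (1ℚ - τ) * ⟦ suc k ⟧         ≡⟨ cong ((1ℚ - τ) *_) (ι-neg c) ⟩
  (1ℚ - τ) * - ι c             ≡⟨ solve 2 (λ τ c → (con 1ℚ :- τ) :* (:- c) :=
                                    τ :* c :+ con (- 1ℚ) :* c) refl τ (ι c) ⟩
  τ * ι c + - 1ℚ * ι c         ≤⟨ p+q≤p+r⇒q≤r X _ _ heights ⟩
  V * ε                        ∎
  where
  open ℚ.≤-Reasoning
  open Near near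
  V = ⟦ sumℕ (ℤ.∣_∣ ∘ v) ⟧
  χ : Fin d → ℚ
  χ = ⟦_⟧ ∘ topCorner ∘ v
  X = sumℚ (λ i → ι (v i) * χ i)

  form : ∀ (b : Fin d → ℕ) → sumℤ (λ i → v i ℤ.* + b i) ≡ c →
         ∀ t → sumℚ (λ i → t * (ι (v i) * ⟦ b i ⟧)) ≡ t * ι c
  form b vb≡c t = begin-equality
    sumℚ (λ i → t * (ι (v i) * ⟦ b i ⟧))
      ≡⟨ sumℚ-* t (λ i → ι (v i) * ⟦ b i ⟧) ⟨
    t * sumℚ (λ i → ι (v i) * ⟦ b i ⟧)
      ≡⟨ cong (t *_) (sumℚ-cong (λ i → ι-* (v i) (+ b i))) ⟨
    t * sumℚ (λ i → ι (v i ℤ.* + b i))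
      ≡⟨ cong (t *_) (ι-sum (λ i → v i ℤ.* + b i)) ⟨
    t * ι (sumℤ (λ i → v i ℤ.* + b i))
      ≡⟨ cong (λ z → t * ι z) vb≡c ⟩
    t * ι c ∎

  w : Fin d → ℚ
  w i = χ i + τ * ⟦ a i ⟧ - ⟦ a′ i ⟧

  -ε≤w : ∀ i → - ε ≤ w i
  -ε≤w i = subst₂ _≤_
    (solve 2 (λ a′ ε → a′ :- (a′ :+ ε) := :- ε) refl ⟦ a′ i ⟧ ε)
    (solve 3 (λ p a′ ε → p :+ ε :- (a′ :+ ε) := p :- a′) refl (χ i + τ * ⟦ a i ⟧) ⟦ a′ i ⟧ ε)
    (ℚ.+-monoˡ-≤ (- (⟦ a′ i ⟧ + ε)) (lower i))

  w≤1+ε : ∀ i → w i ≤ 1ℚ + ε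
  w≤1+ε i = subst (w i ≤_)
    (solve 2 (λ a′ ε → con 1ℚ :+ a′ :+ ε :- a′ := con 1ℚ :+ ε) refl ⟦ a′ i ⟧ ε)
    (ℚ.+-monoˡ-≤ (- ⟦ a′ i ⟧) (upper i))

  -- The form takes the value `X + τ c - c` at `w`, the point of parameter `τ` relative to `a′`.
  -- Applying `topCorner-max` in every coordinate bounds this by `X + V ε`.
  heights : X + (τ * ι c + - 1ℚ * ι c) ≤ X + V * ε
  heights = begin
    X + (τ * ι c + - 1ℚ * ι c)
      ≡⟨ cong (λ z → X + z) (cong₂ _+_ (form a va≡c τ) (form a′ va′≡c (- 1ℚ))) ⟨
    X + (sumℚ (λ i → τ * (ι (v i) * ⟦ a i ⟧)) + sumℚ (λ i → - 1ℚ * (ι (v i) * ⟦ a′ i ⟧)))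
      ≡⟨ cong (λ z → X + z) (sumℚ-+ (λ i → τ * (ι (v i) * ⟦ a i ⟧)) (λ i → - 1ℚ * (ι (v i) * ⟦ a′ i ⟧))) ⟨
    X + sumℚ (λ i → τ * (ι (v i) * ⟦ a i ⟧) + - 1ℚ * (ι (v i) * ⟦ a′ i ⟧))
      ≡⟨ sumℚ-+ (λ i → ι (v i) * χ i)
                (λ i → τ * (ι (v i) * ⟦ a i ⟧) + - 1ℚ * (ι (v i) * ⟦ a′ i ⟧)) ⟨
    sumℚ (λ i → ι (v i) * χ i + (τ * (ι (v i) * ⟦ a i ⟧) + - 1ℚ * (ι (v i) * ⟦ a′ i ⟧)))
      ≡⟨ sumℚ-cong (λ i → solve 5 (λ v χ τ a a′ →
           v :* χ :+ (τ :* (v :* a) :+ con (- 1ℚ) :* (v :* a′)) := v :* (χ :+ τ :* a :- a′))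
           refl (ι (v i)) (χ i) τ ⟦ a i ⟧ ⟦ a′ i ⟧) ⟩
    sumℚ (λ i → ι (v i) * w i)
      ≤⟨ sumℚ-mono-≤ (λ i → topCorner-max (v i) (w i) ε (-ε≤w i) (w≤1+ε i)) ⟩
    sumℚ (λ i → ι (v i) * χ i + ⟦ ℤ.∣ v i ∣ ⟧ * ε)
      ≡⟨ sumℚ-+ (λ i → ι (v i) * χ i) (λ i → ⟦ ℤ.∣ v i ∣ ⟧ * ε) ⟩
    X + sumℚ (λ i → ⟦ ℤ.∣ v i ∣ ⟧ * ε)
      ≡⟨ cong (λ z → X + z) (sumℚ-cong (λ i → ℚ.*-comm ⟦ ℤ.∣ v i ∣ ⟧ ε)) ⟩
    X + sumℚ (λ i → ε * ⟦ ℤ.∣ v i ∣ ⟧)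
      ≡⟨ cong (λ z → X + z) (sumℚ-* ε (λ i → ⟦ ℤ.∣ v i ∣ ⟧)) ⟨
    X + ε * sumℚ (λ i → ⟦ ℤ.∣ v i ∣ ⟧)
      ≡⟨ cong (λ z → X + ε * z) (⟦⟧-sum (ℤ.∣_∣ ∘ v)) ⟨
    X + ε * V
      ≡⟨ cong (λ z → X + z) (ℚ.*-comm ε V) ⟩
    X + V * ε ∎
near-end v {c = + _} (ℤ.+<+ ())

-- From real segments to rational approximations and back to integers

Eventually : (ℕ → Set) → Set
Eventually P = ∃ λ N → ∀ {k} → N ℕ.≤ k → P k

eventually-∀ : ∀ {d} {P : Fin d → ℕ → Set} → (∀ i → Eventually (P i)) →
               Eventually (λ k → ∀ i → P i k)
eventually-∀ {zero}  ev = 0 , λ _ ()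
eventually-∀ {suc d} ev =
  let M , f = ev zero
      N , g = eventually-∀ (ev ∘ suc)
  in M ℕ.⊔ N , λ M⊔N≤k → λ where
    zero    → f (ℕ.m⊔n≤o⇒m≤o M N M⊔N≤k)
    (suc i) → g (ℕ.m⊔n≤o⇒n≤o M N M⊔N≤k) i

⟦1+_⟧ : ∀ n → ⟦ suc n ⟧ ≡ 1ℚ + ⟦ n ⟧
⟦1+ n ⟧ = ⟦⟧-+ 1 n

-- Each real inequality holds up to `ε` from some index on, and `τ` is the approximation of the
-- parameter at one index beyond all these thresholds. Both ends have integer coordinates, given by
-- constant sequences, so they contribute no error.
segment⇒near : ∀ {d n} (x a : Fin d → ℕ) (Q : Cube d n) →
               SegmentMeets (fromℕ ∘ x) (λ i → fromℕ (x i ℕ.+ a i)) Q →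
               ∀ ε → 0ℚ ℚ.< ε → ∃ λ τ → Near x a (corner Q) τ ε
segment⇒near x a Q (t , 0≤t , t≤1 , t∈Q) ε ε>0 =
  let K , f = 0≤t ε ε>0
      L , g = t≤1 ε ε>0
      M , l = eventually-∀ (λ i → proj₁ (t∈Q i) ε ε>0)
      N , u = eventually-∀ (λ i → proj₂ (t∈Q i) ε ε>0)
      k     = K ℕ.+ L ℕ.+ (M ℕ.+ N)
      M+N≤k = ℕ.m≤n+m (M ℕ.+ N) (K ℕ.+ L)
      K+L≤k = ℕ.m≤m+n (K ℕ.+ L) (M ℕ.+ N)
      τ     = seq t k
      point : ∀ i → (⟦ 1 ⟧ + - τ) * ⟦ x i ⟧ + τ * ⟦ x i ℕ.+ a i ⟧ ≡ ⟦ x i ⟧ + τ * ⟦ a i ⟧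
      point i = trans (cong (λ z → (⟦ 1 ⟧ + - τ) * ⟦ x i ⟧ + τ * z) (⟦⟧-+ (x i) (a i)))
        (solve 3 (λ x a τ → (con 1ℚ :+ :- τ) :* x :+ τ :* (x :+ a) := x :+ τ :* a)
          refl ⟦ x i ⟧ ⟦ a i ⟧ τ)
  in τ , record
    { 0≤τ+ε = f (ℕ.≤-trans (ℕ.m≤m+n K L) K+L≤k)
    ; τ≤1+ε = g (ℕ.≤-trans (ℕ.m≤n+m L K) K+L≤k)
    ; lower = λ i → subst (λ z → ⟦ corner Q i ⟧ ≤ z + ε) (point i)
        (l (ℕ.≤-trans (ℕ.m≤m+n M N) M+N≤k) i)
    ; upper = λ i → subst₂ (λ z z′ → z ≤ z′ + ε) (point i) ⟦1+ corner Q i ⟧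
        (u (ℕ.≤-trans (ℕ.m≤n+m N M) M+N≤k) i)
    }

-- Integrality absorbs an error below 1; this recovers exact statements from approximate ones.
⟦⟧-round : ∀ {m n δ} → ⟦ m ⟧ ≤ ⟦ n ⟧ + δ → δ ≤ ½ → m ℕ.≤ n
⟦⟧-round {m} {n} {δ} m≤n+δ δ≤½ with m ℕ.≤? n
... | yes m≤n = m≤n
... | no  m≰n = contradiction (begin-strict
  ⟦ n ⟧ + ½     <⟨ ℚ.+-monoʳ-< ⟦ n ⟧ {½} {1ℚ} (ℚ.*<* (ℤ.+<+ (ℕ.s≤s (ℕ.s≤s ℕ.z≤n)))) ⟩
  ⟦ n ⟧ + 1ℚ    ≡⟨ ℚ.+-comm ⟦ n ⟧ 1ℚ ⟩
  1ℚ + ⟦ n ⟧    ≡⟨ ⟦1+ n ⟧ ⟨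
  ⟦ suc n ⟧     ≤⟨ ⟦⟧-mono-≤ (ℕ.≰⇒> m≰n) ⟩
  ⟦ m ⟧         ≤⟨ m≤n+δ ⟩
  ⟦ n ⟧ + δ     ≤⟨ ℚ.+-monoʳ-≤ ⟦ n ⟧ δ≤½ ⟩
  ⟦ n ⟧ + ½     ∎) (ℚ.<-irrefl refl)
  where open ℚ.≤-Reasoning

-- At `τ = 1` and `ε = 0`, `lower` and `upper` read `a′ ≤ x + a` and `x + a ≤ 1 + a′`. In general
-- the errors are `(1 + a) ε` and `(1 + V a) ε`; the factor in the smallness assumption dominates
-- both.
near-end-coordinate : ∀ {d} {x a a′ : Fin d → ℕ} {τ ε} V i → x i ℕ.≤ 1 → 0ℚ ≤ ε →
  ⟦ suc (V ℕ.+ 1) ℕ.* suc (a i) ⟧ * ε ≤ ½ →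
  1ℚ - τ ≤ ⟦ V ⟧ * ε → Near x a a′ τ ε →
  a′ i ℕ.≤ suc (a i) × a i ℕ.≤ suc (a′ i)
near-end-coordinate {x = x} {a} {a′} {τ} {ε} V i x≤1 0≤ε small 1-τ≤ near =
  ⟦⟧-round {n = suc A} (begin
    ⟦ a′ i ⟧                          ≤⟨ lower i ⟩
    ⟦ x i ⟧ + τ * ⟦ A ⟧ + ε           ≤⟨ ℚ.+-monoˡ-≤ ε (ℚ.+-mono-≤ (⟦⟧-mono-≤ x≤1)
                                          (ℚ.*-monoʳ-≤-nonNeg ⟦ A ⟧ {{⟦⟧-nonNeg A}} τ≤1+ε)) ⟩
    1ℚ + (1ℚ + ε) * ⟦ A ⟧ + ε         ≡⟨ solve 2 (λ a ε → con 1ℚ :+ (con 1ℚ :+ ε) :* a :+ ε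
                                          := (con 1ℚ :+ a) :+ (con 1ℚ :+ a) :* ε) refl ⟦ A ⟧ ε ⟩
    (1ℚ + ⟦ A ⟧) + (1ℚ + ⟦ A ⟧) * ε   ≡⟨ cong (λ z → z + z * ε) ⟦1+ A ⟧ ⟨
    ⟦ suc A ⟧ + ⟦ suc A ⟧ * ε         ∎)
    (ℚ.≤-trans (ℚ.*-monoʳ-≤-nonNeg ε {{ℚ.nonNegative 0≤ε}}
      (⟦⟧-mono-≤ (ℕ.m≤n*m (suc A) (suc (V ℕ.+ 1))))) small) ,
  ⟦⟧-round {n = suc (a′ i)} (begin
    ⟦ A ⟧                                      ≡⟨ solve 2 (λ τ a → a := con 0ℚ :+ τ :* a :+ (con 1ℚ :- τ) :* a)
                                                    refl τ ⟦ A ⟧ ⟩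
    0ℚ + τ * ⟦ A ⟧ + (1ℚ - τ) * ⟦ A ⟧          ≤⟨ ℚ.+-mono-≤
                                                    (ℚ.+-monoˡ-≤ (τ * ⟦ A ⟧) 0≤⟦ x i ⟧)
                                                    (ℚ.*-monoʳ-≤-nonNeg ⟦ A ⟧ {{⟦⟧-nonNeg A}} 1-τ≤) ⟩
    ⟦ x i ⟧ + τ * ⟦ A ⟧ + ⟦ V ⟧ * ε * ⟦ A ⟧     ≤⟨ ℚ.+-monoˡ-≤ (⟦ V ⟧ * ε * ⟦ A ⟧) (upper i) ⟩
    (1ℚ + ⟦ a′ i ⟧) + ε + ⟦ V ⟧ * ε * ⟦ A ⟧     ≡⟨ solve 4 (λ b ε v a → (con 1ℚ :+ b) :+ ε :+ v :* ε :* a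
                                                    := (con 1ℚ :+ b) :+ (con 1ℚ :+ v :* a) :* ε)
                                                    refl ⟦ a′ i ⟧ ε ⟦ V ⟧ ⟦ A ⟧ ⟩
    (1ℚ + ⟦ a′ i ⟧) + (1ℚ + ⟦ V ⟧ * ⟦ A ⟧) * ε  ≡⟨ cong (λ z → (1ℚ + ⟦ a′ i ⟧) + (1ℚ + z) * ε) (⟦⟧-* V A) ⟨
    (1ℚ + ⟦ a′ i ⟧) + (1ℚ + ⟦ V ℕ.* A ⟧) * ε    ≡⟨ cong₂ (λ y z → y + z * ε) ⟦1+ a′ i ⟧ ⟦1+ V ℕ.* A ⟧ ⟨
    ⟦ suc (a′ i) ⟧ + ⟦ suc (V ℕ.* A) ⟧ * ε      ∎)
    (ℚ.≤-trans (ℚ.*-monoʳ-≤-nonNeg ε {{ℚ.nonNegative 0≤ε}} (⟦⟧-mono-≤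
      (ℕ.+-mono-≤ (ℕ.s≤s (ℕ.z≤n {A}))
        (ℕ.*-mono-≤ (ℕ.m≤m+n V 1) (ℕ.n≤1+n A))))) small)
  where
  open ℚ.≤-Reasoning
  open Near near
  A = a i

-- With `ε` small against `V` and `a i`, only cubes equal to the target or touching it remain. The
-- spacing of the depths excludes the touching ones later.
near-same-form : ∀ {d n} (v : Fin d → ℤ) (a : Fin d → ℕ) (Q : Cube d n) {c} → c ℤ.< + 0 →
  sumℤ (λ i → v i ℤ.* + a i) ≡ c → sumℤ (λ i → v i ℤ.* + corner Q i) ≡ c →
  SegmentMeets (fromℕ ∘ topCorner ∘ v) (λ i → fromℕ (topCorner (v i) ℕ.+ a i)) Q →
  ∀ i → corner Q i ℕ.≤ suc (a i) × a i ℕ.≤ suc (corner Q i)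
near-same-form v a Q c<0 va≡c vQ≡c meets i =
  let V = sumℕ (ℤ.∣_∣ ∘ v)
      H = suc (V ℕ.+ 1) ℕ.* suc (a i)
      ε , ε>0 , Hε≡½ = shrink ⟦ H ⟧ 1ℚ
        (ℚ.<-≤-trans (ℚ.positive⁻¹ 1ℚ) (⟦⟧-mono-≤ {1} {H} (ℕ.s≤s ℕ.z≤n))) (ℚ.positive⁻¹ 1ℚ)
      τ , near = segment⇒near (topCorner ∘ v) a Q meets ε ε>0
      0≤ε = ℚ.<⇒≤ ε>0
  in near-end-coordinate V i (topCorner≤1 (v i)) 0≤ε (ℚ.≤-reflexive Hε≡½)
       (near-end v c<0 va≡c vQ≡c 0≤ε near) near

-- Tubes are far enough apart for the crude choice `ε = 1` to tell them apart. Of the bound 2, one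
-- unit is `ε` and the other is the start `x` or the width of the cube.
near-bounds : ∀ {d} {x a a′ : Fin d → ℕ} {τ} → (∀ i → x i ℕ.≤ 1) → Near x a a′ τ 1ℚ →
  ∣ τ ∣ ≤ ⟦ 2 ⟧ × (∀ i → ∣ τ * ⟦ a i ⟧ - ⟦ a′ i ⟧ ∣ ≤ ⟦ 2 ⟧)
near-bounds {x = x} {a} {a′} {τ} x≤1 near =
  ∣-∣-≤ τ τ≤1+ε (ℚ.≤-trans
    (subst (_≤ 1ℚ) (solve 1 (λ τ → con 0ℚ :- τ := :- τ) refl τ)
      (p≤q+r⇒p-q≤r 0ℚ τ 1ℚ 0≤τ+ε))
    (⟦⟧-mono-≤ {1} {2} (ℕ.s≤s ℕ.z≤n))) ,
  λ i → ∣-∣-≤ (τ * ⟦ a i ⟧ - ⟦ a′ i ⟧)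
    (p≤q+r⇒p-q≤r (τ * ⟦ a i ⟧) ⟦ a′ i ⟧ ⟦ 2 ⟧ (begin
      τ * ⟦ a i ⟧               ≡⟨ ℚ.+-identityˡ _ ⟨
      0ℚ + τ * ⟦ a i ⟧          ≤⟨ ℚ.+-monoˡ-≤ (τ * ⟦ a i ⟧) 0≤⟦ x i ⟧ ⟩
      ⟦ x i ⟧ + τ * ⟦ a i ⟧     ≤⟨ upper i ⟩
      (1ℚ + ⟦ a′ i ⟧) + 1ℚ      ≡⟨ solve 1 (λ b → con 1ℚ :+ b :+ con 1ℚ := b :+ con ⟦ 2 ⟧) refl ⟦ a′ i ⟧ ⟩
      ⟦ a′ i ⟧ + ⟦ 2 ⟧          ∎))
    (subst (_≤ ⟦ 2 ⟧) (solve 2 (λ p q → q :- p := :- (p :- q)) refl (τ * ⟦ a i ⟧) ⟦ a′ i ⟧)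
      (p≤q+r⇒p-q≤r ⟦ a′ i ⟧ (τ * ⟦ a i ⟧) ⟦ 2 ⟧ (begin
        ⟦ a′ i ⟧                      ≤⟨ lower i ⟩
        ⟦ x i ⟧ + τ * ⟦ a i ⟧ + 1ℚ    ≤⟨ ℚ.+-monoˡ-≤ 1ℚ (ℚ.+-monoˡ-≤ (τ * ⟦ a i ⟧) (⟦⟧-mono-≤ (x≤1 i))) ⟩
        1ℚ + τ * ⟦ a i ⟧ + 1ℚ         ≡⟨ solve 1 (λ b → con 1ℚ :+ b :+ con 1ℚ := b :+ con ⟦ 2 ⟧) refl (τ * ⟦ a i ⟧) ⟩
        τ * ⟦ a i ⟧ + ⟦ 2 ⟧           ∎)))
  where
  open ℚ.≤-Reasoning
  open Near near

-- Linear forms constant on many points near a ray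

length-filter-⊎ : ∀ {A : Set} {P Q R : A → Set}
  (P? : Decidable P) (Q? : Decidable Q) (R? : Decidable R) → (∀ x → P x → Q x ⊎ R x) →
  ∀ xs → length (filter P? xs) ℕ.≤ length (filter Q? xs) ℕ.+ length (filter R? xs)
length-filter-⊎ P? Q? R? P⇒Q⊎R []       = ℕ.z≤n
length-filter-⊎ P? Q? R? P⇒Q⊎R (x ∷ xs)
  with P? x | Q? x | R? x | length-filter-⊎ P? Q? R? P⇒Q⊎R xs
... | no _  | no _  | no _  | ih = ih
... | no _  | no _  | yes _ | ih = ℕ.≤-trans ih (ℕ.+-monoʳ-≤ _ (ℕ.n≤1+n _))
... | no _  | yes _ | no _  | ih = ℕ.m≤n⇒m≤1+n ih
... | no _  | yes _ | yes _ | ih = ℕ.m≤n⇒m≤1+n (ℕ.≤-trans ih (ℕ.+-monoʳ-≤ _ (ℕ.n≤1+n _)))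
... | yes _ | yes _ | no _  | ih = ℕ.s≤s ih
... | yes _ | yes _ | yes _ | ih = ℕ.s≤s (ℕ.≤-trans ih (ℕ.+-monoʳ-≤ _ (ℕ.n≤1+n _)))
... | yes _ | no _  | yes _ | ih = ℕ.≤-trans (ℕ.s≤s ih) (ℕ.≤-reflexive (sym (ℕ.+-suc _ _)))
... | yes p | no ¬q | no ¬r | _ with P⇒Q⊎R x p
...   | inj₁ q = contradiction q ¬q
...   | inj₂ r = contradiction r ¬r

module _ {A : Set} (f : A → ℕ) where

  count : ℕ → List A → ℕ
  count k xs = length (filter (λ x → f x ℕ.≟ k) xs)

  count-below : ℕ → List A → ℕ
  count-below K xs = length (filter (λ x → f x ℕ.<? K) xs)

  count-below-suc : ∀ K xs → count-below (suc K) xs ℕ.≤ count K xs ℕ.+ count-below K xs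
  count-below-suc K = length-filter-⊎ _ _ _ split
    where
    split : ∀ x → f x ℕ.< suc K → f x ≡ K ⊎ f x ℕ.< K
    split x fx<1+K with ℕ.m≤n⇒m<n∨m≡n (ℕ.s≤s⁻¹ fx<1+K)
    ... | inj₁ fx<K = inj₂ fx<K
    ... | inj₂ fx≡K = inj₁ fx≡K

  popular-below : ∀ K xs → ∃ λ k → count-below K xs ℕ.≤ K ℕ.* count k xs
  popular-below zero    xs = 0 , ℕ.≤-reflexive
    (cong length (List.filter-none (λ x → f x ℕ.<? 0) (All.universal (λ _ ()) xs)))
  popular-below (suc K) xs with popular-below K xs
  ... | k , below≤ with count K xs ℕ.≤? count k xs
  ...   | yes K≤k = k , ℕ.≤-trans (count-below-suc K xs) (ℕ.+-mono-≤ K≤k below≤)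
  ...   | no  K≰k = K , ℕ.≤-trans (count-below-suc K xs) (ℕ.+-monoʳ-≤ (count K xs)
                      (ℕ.≤-trans below≤ (ℕ.*-monoʳ-≤ K (ℕ.≰⇒≥ K≰k))))

  popular : ∀ K xs → (∀ x → f x ℕ.< K) → ∃ λ k → length xs ℕ.≤ K ℕ.* count k xs
  popular K xs f<K =
    let k , le = popular-below K xs
    in k , subst (ℕ._≤ K ℕ.* count k xs)
             (cong length (List.filter-all (λ x → f x ℕ.<? K) (All.universal f<K xs))) le

infix 7 _∙_

_∙_ : ∀ {d} → (Fin d → ℤ) → (Fin d → ℕ) → ℤ
v ∙ a = sumℤ (λ j → v j ℤ.* + a j)

∣sumℤ∣≤ : ∀ {d} (f : Fin d → ℤ) {B} → (∀ j → ℤ.∣ f j ∣ ℕ.≤ B) → ℤ.∣ sumℤ f ∣ ℕ.≤ d ℕ.* B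
∣sumℤ∣≤ {zero}  f f≤ = ℕ.z≤n
∣sumℤ∣≤ {suc d} f f≤ = ℕ.≤-trans (ℤ.∣i+j∣≤∣i∣+∣j∣ (f zero) (sumℤ (f ∘ suc)))
  (ℕ.+-mono-≤ (f≤ zero) (∣sumℤ∣≤ (f ∘ suc) (f≤ ∘ suc)))

sumℕ≤ : ∀ {d} (f : Fin d → ℕ) {B} → (∀ j → f j ℕ.≤ B) → sumℕ f ℕ.≤ d ℕ.* B
sumℕ≤ {zero}  f f≤ = ℕ.z≤n
sumℕ≤ {suc d} f f≤ = ℕ.+-mono-≤ (f≤ zero) (sumℕ≤ (f ∘ suc) (f≤ ∘ suc))

pos-sum : ∀ {d} (f : Fin d → ℕ) → + sumℕ f ≡ sumℤ (λ j → + f j)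
pos-sum {zero}  f = refl
pos-sum {suc d} f = cong (λ z → + f zero ℤ.+ z) (pos-sum (f ∘ suc))

∣∙∣≤ : ∀ {d} (v : Fin d → ℤ) (a : Fin d → ℕ) {M N} → (∀ j → ℤ.∣ v j ∣ ℕ.≤ M) → (∀ j → a j ℕ.≤ N) →
       ℤ.∣ v ∙ a ∣ ℕ.≤ d ℕ.* (M ℕ.* N)
∣∙∣≤ v a v≤ a≤ = ∣sumℤ∣≤ _ λ j → subst (ℕ._≤ _) (sym (ℤ.abs-* (v j) (+ a j)))
  (ℕ.*-mono-≤ (v≤ j) (a≤ j))

∙-cong : ∀ {d} (v : Fin d → ℤ) {a b : Fin d → ℕ} → (∀ j → a j ≡ b j) → v ∙ a ≡ v ∙ b
∙-cong v a≡b = sumℤ-cong (λ j → cong (λ z → v j ℤ.* + z) (a≡b j))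

∙-distribˡ-+ : ∀ {d} (v : Fin d → ℤ) (a b : Fin d → ℕ) →
               v ∙ (λ j → a j ℕ.+ b j) ≡ v ∙ a ℤ.+ v ∙ b
∙-distribˡ-+ v a b = trans
  (sumℤ-cong (λ j → ℤ.*-distribˡ-+ (v j) (+ a j) (+ b j)))
  (sumℤ-+ (λ j → v j ℤ.* + a j) (λ j → v j ℤ.* + b j))

neg-∙ : ∀ {d} (v : Fin d → ℤ) (a : Fin d → ℕ) → (λ j → ℤ.- v j) ∙ a ≡ ℤ.- (v ∙ a)
neg-∙ {zero}  v a = refl
neg-∙ {suc d} v a = trans
  (cong₂ ℤ._+_ (sym (ℤ.neg-distribˡ-* (v zero) (+ a zero))) (neg-∙ (v ∘ suc) (a ∘ suc)))
  (sym (ℤ.neg-distrib-+ (v zero ℤ.* + a zero) ((v ∘ suc) ∙ (a ∘ suc))))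

∙-distribʳ-- : ∀ {d} (u v : Fin d → ℤ) (a : Fin d → ℕ) →
               (λ j → u j ℤ.- v j) ∙ a ≡ u ∙ a ℤ.- v ∙ a
∙-distribʳ-- u v a = trans
  (sumℤ-cong (λ j → ℤ.*-distribʳ-+ (+ a j) (u j) (ℤ.- v j)))
  (trans (sumℤ-+ (λ j → u j ℤ.* + a j) (λ j → ℤ.- v j ℤ.* + a j))
         (cong (λ z → u ∙ a ℤ.+ z) (neg-∙ v a)))

∣m-n∣≤ : ∀ {m n B} → m ℕ.≤ B → n ℕ.≤ B → ℤ.∣ + m ℤ.- + n ∣ ℕ.≤ B
∣m-n∣≤ {m} {n} m≤B n≤B = subst (λ z → ℤ.∣ z ∣ ℕ.≤ _) (sym (ℤ.m-n≡m⊖n m n))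
  (ℕ.≤-trans (ℤ.∣m⊝n∣≤m⊔n m n) (ℕ.⊔-lub m≤B n≤B))

finToFun-injective : ∀ {m d} (x y : Fin (m ^ d)) →
  (∀ j → finToFun {m} {d} x j ≡ finToFun y j) → x ≡ y
finToFun-injective {m} {d} x y eq = begin
  x                              ≡⟨ Fin.funToFin-finToFin {d} {m} x ⟨
  funToFin (finToFun {m} {d} x)  ≡⟨ funToFin-cong (finToFun {m} {d} x) (finToFun y) eq ⟩
  funToFin (finToFun {m} {d} y)  ≡⟨ Fin.funToFin-finToFin {d} {m} y ⟩
  y                              ∎
  where
  open ≡-Reasoning
  funToFin-cong : ∀ {d} (f g : Fin d → Fin m) → (∀ j → f j ≡ g j) → funToFin f ≡ funToFin g
  funToFin-cong {zero}  f g eq = refl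
  funToFin-cong {suc d} f g eq = cong₂ Fin.combine (eq zero) (funToFin-cong (f ∘ suc) (g ∘ suc) (eq ∘ suc))

-- Dirichlet's theorem: the integer vectors with entries in [0 , N] have values in [0 , d N n] on p,
-- which n boxes of width d N + 1 cover.
dirichlet : ∀ {d n N} .{{_ : ℕ.NonZero n}} → n ℕ.< suc N ^ d →
  (p : Fin d → ℕ) → (∀ j → p j ℕ.≤ n) →
  ∃ λ v → (∃ λ j → v j ≢ + 0) × (∀ j → ℤ.∣ v j ∣ ℕ.≤ N) × ℤ.∣ v ∙ p ∣ ℕ.≤ d ℕ.* N
dirichlet {d} {n} {N} n<[1+N]^d p p≤n =
  let x , y , x<y , same-box = Fin.pigeonhole n<[1+N]^d box
  in difference x y , difference≢0 x<y , difference≤N x y , difference-form≤ x y same-box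
  where
  u : Fin (suc N ^ d) → Fin d → ℕ
  u x j = toℕ (finToFun {suc N} {d} x j)
  u≤N : ∀ x j → u x j ℕ.≤ N
  u≤N x j = Fin.toℕ≤pred[n] (finToFun {suc N} {d} x j)
  value : Fin (suc N ^ d) → ℕ
  value x = sumℕ (λ j → u x j ℕ.* p j)
  W = suc (d ℕ.* N)
  value<nW : ∀ x → value x ℕ.< n ℕ.* W
  value<nW x = begin-strict
    value x            ≤⟨ sumℕ≤ _ (λ j → ℕ.*-mono-≤ (u≤N x j) (p≤n j)) ⟩
    d ℕ.* (N ℕ.* n)    ≡⟨ ℕ.*-assoc d N n ⟨
    d ℕ.* N ℕ.* n      <⟨ ℕ.*-monoˡ-< n (ℕ.n<1+n (d ℕ.* N)) ⟩
    W ℕ.* n            ≡⟨ ℕ.*-comm W n ⟩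
    n ℕ.* W            ∎
    where open ℕ.≤-Reasoning
  box : Fin (suc N ^ d) → Fin n
  box x = fromℕ< (ℕ.m<n*o⇒m/o<n {value x} {n} {W} (value<nW x))
  difference : ∀ x y → Fin d → ℤ
  difference x y j = + u x j ℤ.- + u y j
  difference≤N : ∀ x y j → ℤ.∣ difference x y j ∣ ℕ.≤ N
  difference≤N x y j = ∣m-n∣≤ (u≤N x j) (u≤N y j)
  difference≢0 : ∀ {x y} → x Fin.< y → ∃ λ j → difference x y j ≢ + 0
  difference≢0 {x} {y} x<y
    with j , x≢y ← Fin.¬∀⟶∃¬ d _ (λ j → finToFun {suc N} {d} x j Fin.≟ finToFun y j)
           (λ eq → Fin.<⇒≢ x<y (finToFun-injective {suc N} {d} x y eq))
    = j , λ eq → x≢y (Fin.toℕ-injective (ℤ.+-injective (ℤ.i-j≡0⇒i≡j _ _ eq)))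
  -- Values in the same box differ by the difference of their remainders modulo `W`, which lie in
  -- `[0 , d N]`.
  r : Fin (suc N ^ d) → ℕ
  r x = value x ℕ.% W
  value-split : ∀ x → (λ j → + u x j) ∙ p ≡ + r x ℤ.+ + (value x ℕ./ W) ℤ.* + W
  value-split x = begin
    sumℤ (λ j → + u x j ℤ.* + p j)
      ≡⟨ sumℤ-cong (λ j → sym (ℤ.pos-* (u x j) (p j))) ⟩
    sumℤ (λ j → + (u x j ℕ.* p j))
      ≡⟨ pos-sum (λ j → u x j ℕ.* p j) ⟨
    + value x
      ≡⟨ cong (λ z → + z) (ℕ.m≡m%n+[m/n]*n (value x) W) ⟩
    + (r x ℕ.+ value x ℕ./ W ℕ.* W)
      ≡⟨ cong (λ z → + r x ℤ.+ z) (ℤ.pos-* (value x ℕ./ W) W) ⟩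
    + r x ℤ.+ + (value x ℕ./ W) ℤ.* + W ∎
    where open ≡-Reasoning
  difference-form : ∀ x y → value x ℕ./ W ≡ value y ℕ./ W → difference x y ∙ p ≡ + r x ℤ.- + r y
  difference-form x y same-quotient = begin
    difference x y ∙ p
      ≡⟨ ∙-distribʳ-- (λ j → + u x j) (λ j → + u y j) p ⟩
    (λ j → + u x j) ∙ p ℤ.- (λ j → + u y j) ∙ p
      ≡⟨ cong₂ ℤ._-_ (value-split x) (value-split y) ⟩
    (+ r x ℤ.+ + (value x ℕ./ W) ℤ.* + W) ℤ.- (+ r y ℤ.+ + (value y ℕ./ W) ℤ.* + W)
      ≡⟨ cong (λ z → (+ r x ℤ.+ + z ℤ.* + W) ℤ.- (+ r y ℤ.+ + (value y ℕ./ W) ℤ.* + W)) same-quotient ⟩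
    (+ r x ℤ.+ + (value y ℕ./ W) ℤ.* + W) ℤ.- (+ r y ℤ.+ + (value y ℕ./ W) ℤ.* + W)
      ≡⟨ cancel (+ r x) (+ r y) (+ (value y ℕ./ W) ℤ.* + W) ⟩
    + r x ℤ.- + r y ∎
    where
    open ≡-Reasoning
    cancel : ∀ a b c → (a ℤ.+ c) ℤ.- (b ℤ.+ c) ≡ a ℤ.- b
    cancel = ℤ-solve-∀
  difference-form≤ : ∀ x y → box x ≡ box y → ℤ.∣ difference x y ∙ p ∣ ℕ.≤ d ℕ.* N
  difference-form≤ x y same-box = subst (λ z → ℤ.∣ z ∣ ℕ.≤ d ℕ.* N)
    (sym (difference-form x y
      (trans (sym (Fin.toℕ-fromℕ< _)) (trans (cong toℕ same-box) (Fin.toℕ-fromℕ< _)))))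
    (∣m-n∣≤ (ℕ.s≤s⁻¹ (ℕ.m%n<n (value x) W)) (ℕ.s≤s⁻¹ (ℕ.m%n<n (value y) W)))

-- If p ≈ (n / s) a then v ∙ a ≈ (s / n) (v ∙ p).
near-ray-form : ∀ {d n N s} .{{_ : ℕ.NonZero n}} (v : Fin d → ℤ) (p : Fin d → ℕ) →
  (∀ j → ℤ.∣ v j ∣ ℕ.≤ N) → ℤ.∣ v ∙ p ∣ ℕ.≤ d ℕ.* N → s ℕ.≤ n →
  ℤ.∣ v ∙ (λ j → s ℕ.* p j ℕ./ n) ∣ ℕ.≤ 2 ℕ.* (d ℕ.* N)
near-ray-form {d} {n} {N} {s} v p v≤N v∙p≤ s≤n = ℕ.*-cancelˡ-≤ n (let open ℕ.≤-Reasoning in begin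
  n ℕ.* ℤ.∣ v ∙ a ∣
    ≡⟨ ℤ.abs-* (+ n) (v ∙ a) ⟨
  ℤ.∣ + n ℤ.* (v ∙ a) ∣
    ≡⟨ cong ℤ.∣_∣ identity ⟩
  ℤ.∣ + s ℤ.* (v ∙ p) ℤ.- v ∙ r ∣
    ≤⟨ ℤ.∣i-j∣≤∣i∣+∣j∣ (+ s ℤ.* (v ∙ p)) (v ∙ r) ⟩
  ℤ.∣ + s ℤ.* (v ∙ p) ∣ ℕ.+ ℤ.∣ v ∙ r ∣
    ≡⟨ cong (ℕ._+ ℤ.∣ v ∙ r ∣) (ℤ.abs-* (+ s) (v ∙ p)) ⟩
  s ℕ.* ℤ.∣ v ∙ p ∣ ℕ.+ ℤ.∣ v ∙ r ∣
    -- The remainders satisfy `r j ≤ n`, so rounding costs at most `d N n`, the same bound as for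
    -- `s (v ∙ p)`.
    ≤⟨ ℕ.+-mono-≤ (ℕ.*-mono-≤ s≤n v∙p≤) (∣∙∣≤ v r v≤N (λ j → ℕ.m%n≤n (s ℕ.* p j) n)) ⟩
  n ℕ.* (d ℕ.* N) ℕ.+ d ℕ.* (N ℕ.* n)
    ≡⟨ arith n d N ⟩
  n ℕ.* (2 ℕ.* (d ℕ.* N)) ∎)
  where
  a r : Fin d → ℕ
  a j = s ℕ.* p j ℕ./ n
  r j = s ℕ.* p j ℕ.% n
  arith : ∀ n d N → n ℕ.* (d ℕ.* N) ℕ.+ d ℕ.* (N ℕ.* n) ≡ n ℕ.* (2 ℕ.* (d ℕ.* N))
  arith = ℕ-solve-∀
  split : ∀ j → s ℕ.* p j ≡ r j ℕ.+ n ℕ.* a j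
  split j = trans (ℕ.m≡m%n+[m/n]*n (s ℕ.* p j) n) (cong (r j ℕ.+_) (ℕ.*-comm (a j) n))
  ∙-* : ∀ k (b : Fin d → ℕ) → v ∙ (λ j → k ℕ.* b j) ≡ + k ℤ.* (v ∙ b)
  ∙-* k b = trans
    (sumℤ-cong (λ j → trans (cong (v j ℤ.*_) (ℤ.pos-* k (b j))) (swap (v j) (+ k) (+ b j))))
    (sym (sumℤ-* (+ k) (λ j → v j ℤ.* + b j)))
    where
    swap : ∀ x y z → x ℤ.* (y ℤ.* z) ≡ y ℤ.* (x ℤ.* z)
    swap = ℤ-solve-∀
  identity : + n ℤ.* (v ∙ a) ≡ + s ℤ.* (v ∙ p) ℤ.- v ∙ r
  identity = begin
    + n ℤ.* (v ∙ a)                                ≡⟨ cancel (v ∙ r) (+ n ℤ.* (v ∙ a)) ⟨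
    (v ∙ r ℤ.+ + n ℤ.* (v ∙ a)) ℤ.- v ∙ r          ≡⟨ cong (λ z → (v ∙ r ℤ.+ z) ℤ.- v ∙ r) (∙-* n a) ⟨
    (v ∙ r ℤ.+ v ∙ (λ j → n ℕ.* a j)) ℤ.- v ∙ r    ≡⟨ cong (λ z → z ℤ.- v ∙ r) (∙-distribˡ-+ v r (λ j → n ℕ.* a j)) ⟨
    v ∙ (λ j → r j ℕ.+ n ℕ.* a j) ℤ.- v ∙ r        ≡⟨ cong (λ z → z ℤ.- v ∙ r) (∙-cong v split) ⟨
    v ∙ (λ j → s ℕ.* p j) ℤ.- v ∙ r                ≡⟨ cong (λ z → z ℤ.- v ∙ r) (∙-* s p) ⟩
    + s ℤ.* (v ∙ p) ℤ.- v ∙ r                      ∎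
    where
    open ≡-Reasoning
    cancel : ∀ x y → (x ℤ.+ y) ℤ.- x ≡ y
    cancel = ℤ-solve-∀

unit : ∀ {d} → Fin d → Fin d → ℕ
unit zero    zero    = 1
unit zero    (suc j) = 0
unit (suc i) zero    = 0
unit (suc i) (suc j) = unit i j

unit≤1 : ∀ {d} (i j : Fin d) → unit i j ℕ.≤ 1
unit≤1 zero    zero    = ℕ.≤-refl
unit≤1 zero    (suc j) = ℕ.z≤n
unit≤1 (suc i) zero    = ℕ.z≤n
unit≤1 (suc i) (suc j) = unit≤1 i j

∙-zero : ∀ {d} (v : Fin d → ℤ) → v ∙ (λ _ → 0) ≡ + 0
∙-zero {zero}  v = refl
∙-zero {suc d} v = cong₂ ℤ._+_ (ℤ.*-zeroʳ (v zero)) (∙-zero (v ∘ suc))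

∙-unit : ∀ {d} (v : Fin d → ℤ) i → v ∙ unit i ≡ v i
∙-unit v zero    = trans (cong₂ ℤ._+_ (ℤ.*-identityʳ (v zero)) (∙-zero (v ∘ suc))) (ℤ.+-identityʳ (v zero))
∙-unit v (suc i) = trans (cong₂ ℤ._+_ (ℤ.*-zeroʳ (v zero)) (∙-unit (v ∘ suc) i)) (ℤ.+-identityˡ (v (suc i)))

-- The members are indices of cells `core i + shift` in one tube. A negative level makes the form
-- decrease along sight lines, and `large` bounds the number of members below by `S / K` without a
-- division.
record Sheet {d S} (core : Fin S → Fin d → ℕ) (K : ℕ) : Set where
  field
    form     : Fin d → ℤ
    level    : ℤ
    shift    : Fin d → ℕ
    members  : List (Fin S)
    level<0  : level ℤ.< + 0
    shift≤1  : ∀ j → shift j ℕ.≤ 1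
    distinct : Unique members
    large    : S ℕ.≤ K ℕ.* length members
    on-level : ∀ {i} → i ∈ members → form ∙ (λ j → core i j ℕ.+ shift j) ≡ level

-- The levels are integers in `[- B , B]`. Adding `B` turns them into natural codes below `2 B + 1`,
-- to which `popular` applies; the absolute value in `code` only changes the type, since the sum is
-- nonnegative.
popular-level : ∀ {d S} (core : Fin S → Fin d → ℕ) B (v : Fin d → ℤ) →
  (∀ i → ℤ.∣ v ∙ core i ∣ ℕ.≤ B) →
  ∃ λ c → ∃ λ (is : List (Fin S)) → Unique is × S ℕ.≤ suc (2 ℕ.* B) ℕ.* length is ×
    (∀ {i} → i ∈ is → v ∙ core i ≡ c)
popular-level {S = S} core B v v∙core≤B =
  let k , le = popular code (suc (2 ℕ.* B)) (allFin S) code<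
  in + k ℤ.- + B , filter (λ i → code i ℕ.≟ k) (allFin S)
   , Unique.filter⁺ (λ i → code i ℕ.≟ k) (Unique.allFin⁺ S)
   , subst (ℕ._≤ suc (2 ℕ.* B) ℕ.* count code k (allFin S)) (List.length-tabulate (λ i → i)) le
   , λ {i} i∈ → trans (decode i) (cong (λ z → + z ℤ.- + B)
       (proj₂ (∈-filter⁻ (λ i → code i ℕ.≟ k) {xs = allFin S} i∈)))
  where
  code : Fin S → ℕ
  code i = ℤ.∣ v ∙ core i ℤ.+ + B ∣
  code< : ∀ i → code i ℕ.< suc (2 ℕ.* B)
  code< i = ℕ.s≤s (ℕ.≤-trans (ℤ.∣i+j∣≤∣i∣+∣j∣ (v ∙ core i) (+ B))
    (ℕ.≤-trans (ℕ.+-monoˡ-≤ B (v∙core≤B i)) (ℕ.≤-reflexive (cong (B ℕ.+_) (sym (ℕ.+-identityʳ B))))))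
  0≤[_]+ : ∀ x → ℤ.∣ x ∣ ℕ.≤ B → + 0 ℤ.≤ x ℤ.+ + B
  0≤[ + m ]+ _ = ℤ.+≤+ ℕ.z≤n
  0≤[ -[1+ m ] ]+ m<B = subst (+ 0 ℤ.≤_) (sym (ℤ.⊖-≥ m<B)) (ℤ.+≤+ ℕ.z≤n)
  decode : ∀ i → v ∙ core i ≡ + code i ℤ.- + B
  decode i = trans (sym (cancel (v ∙ core i) (+ B)))
    (cong (λ z → z ℤ.- + B) (sym (ℤ.0≤i⇒+∣i∣≡i (0≤[ v ∙ core i ]+ (v∙core≤B i)))))
    where
    cancel : ∀ x y → x ℤ.+ y ℤ.- y ≡ x
    cancel = ℤ-solve-∀

-- A positive level becomes negative when the form is negated.
sheet-≢0 : ∀ {d S K} {core : Fin S → Fin d → ℕ} (v : Fin d → ℤ) c (z : Fin d → ℕ) (is : List (Fin S)) →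
  c ≢ + 0 → (∀ j → z j ℕ.≤ 1) → Unique is → S ℕ.≤ K ℕ.* length is →
  (∀ {i} → i ∈ is → v ∙ (λ j → core i j ℕ.+ z j) ≡ c) → Sheet core K
sheet-≢0 v (+ zero) z is c≢0 _ _ _ _ = contradiction refl c≢0
sheet-≢0 v c@(-[1+ _ ]) z is _ z≤1 distinct large on-level = record
  { form = v ; level = c ; shift = z ; members = is ; level<0 = ℤ.-<+ ; shift≤1 = z≤1
  ; distinct = distinct ; large = large ; on-level = on-level }
sheet-≢0 v c@(+ suc _) z is _ z≤1 distinct large on-level = record
  { form = λ j → ℤ.- v j ; level = ℤ.- c ; shift = z ; members = is ; level<0 = ℤ.-<+ ; shift≤1 = z≤1
  ; distinct = distinct ; large = large
  ; on-level = λ i∈ → trans (neg-∙ v _) (cong ℤ.-_ (on-level i∈)) }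

-- On the level 0 the sight lines would lie in the sheet, which is then shifted to another level.
sheet-shift : ∀ {d S K} {core : Fin S → Fin d → ℕ} (v : Fin d → ℤ) j c (is : List (Fin S)) → v j ≢ + 0 →
  Unique is → S ℕ.≤ K ℕ.* length is → (∀ {i} → i ∈ is → v ∙ core i ≡ c) → Sheet core K
sheet-shift {core = core} v j c is vj≢0 distinct large on-level with c ℤ.≟ + 0
... | no c≢0 = sheet-≢0 v c (λ _ → 0) is c≢0 (λ _ → ℕ.z≤n) distinct large λ {i} i∈ →
  trans (∙-distribˡ-+ v (core i) (λ _ → 0))
    (trans (cong₂ ℤ._+_ (on-level i∈) (∙-zero v)) (ℤ.+-identityʳ c))
... | yes refl = sheet-≢0 v (v j) (unit j) is vj≢0 (unit≤1 j) distinct large λ {i} i∈ →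
  trans (∙-distribˡ-+ v (core i) (unit j))
    (trans (cong₂ ℤ._+_ (on-level i∈) (∙-unit v j)) (ℤ.+-identityˡ (v j)))

-- By `near-ray-form` the levels lie in `[- 2 d N , 2 d N]`, which leaves `4 d N + 1` values for the
-- pigeonhole.
sheet : ∀ {d n N S} .{{_ : ℕ.NonZero n}} → n ℕ.< suc N ^ d →
  (p : Fin d → ℕ) → (∀ j → p j ℕ.≤ n) → (s : Fin S → ℕ) → (∀ i → s i ℕ.≤ n) →
  Sheet (λ i j → s i ℕ.* p j ℕ./ n) (suc (4 ℕ.* (d ℕ.* N)))
sheet {d} {n} {N} {S} n<[1+N]^d p p≤n s s≤n =
  let v , (j , vj≢0) , v≤N , v∙p≤ = dirichlet n<[1+N]^d p p≤n
      c , is , distinct , large , on-level = popular-level (λ i j → s i ℕ.* p j ℕ./ n)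
        (2 ℕ.* (d ℕ.* N)) v (λ i → near-ray-form v p v≤N v∙p≤ (s≤n i))
  in sheet-shift v j c is vj≢0 distinct
       (subst (λ z → S ℕ.≤ suc z ℕ.* length is) (sym (ℕ.*-assoc 2 2 (d ℕ.* N))) large) on-level

-- The configuration

fromℕ-mono-≤ : ∀ {m n} → m ℕ.≤ n → fromℕ m ≤ᵣ fromℕ n
fromℕ-mono-≤ {m} {n} m≤n ε ε>0 = 0 , λ _ → ℚ.≤-trans
  (ℚ.≤-reflexive (sym (ℚ.+-identityʳ ⟦ m ⟧))) (ℚ.+-mono-≤ (⟦⟧-mono-≤ m≤n) (ℚ.<⇒≤ ε>0))

*-length-concat : ∀ {A : Set} {B K} m (f : Fin m → List A) → (∀ x → B ℕ.≤ K ℕ.* length (f x)) →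
                  m ℕ.* B ℕ.≤ K ℕ.* length (concat (List.tabulate f))
*-length-concat zero    f B≤ = ℕ.z≤n
*-length-concat {B = B} {K} (suc m) f B≤ = begin
  B ℕ.+ m ℕ.* B                        ≤⟨ ℕ.+-mono-≤ (B≤ zero) (*-length-concat {K = K} m (f ∘ suc) (B≤ ∘ suc)) ⟩
  K ℕ.* length (f zero) ℕ.+ K ℕ.* length rest
                                       ≡⟨ ℕ.*-distribˡ-+ K (length (f zero)) (length rest) ⟨
  K ℕ.* (length (f zero) ℕ.+ length rest)
                                       ≡⟨ cong (K ℕ.*_) (List.length-++ (f zero)) ⟨
  K ℕ.* length (f zero List.++ rest)   ∎
  where
  open ℕ.≤-Reasoning
  rest = concat (List.tabulate (f ∘ suc))

module _ {m} {A B : Set} (f : Fin m → A → B) (l : Fin m → List A) where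

  ∈-concat-tabulate⁻ : ∀ {b} → b ∈ concat (List.tabulate (λ x → List.map (f x) (l x))) →
                       ∃₂ λ x a → a ∈ l x × b ≡ f x a
  ∈-concat-tabulate⁻ b∈ with ∈-concat⁻′ (List.tabulate (λ x → List.map (f x) (l x))) b∈
  ... | _ , b∈map , map∈ with ∈-tabulate⁻ map∈
  ...   | x , refl with ∈-map⁻ (f x) b∈map
  ...     | a , a∈ , b≡ = x , a , a∈ , b≡

  unique-concat-tabulate : (∀ x → Unique (l x)) → (∀ x {a b} → f x a ≡ f x b → a ≡ b) →
    (∀ {x y a b} → f x a ≡ f y b → x ≡ y) →
    Unique (concat (List.tabulate (λ x → List.map (f x) (l x))))
  unique-concat-tabulate unique injective same-index = Unique.concat⁺
    (All.tabulate⁺ (λ x → Unique.map⁺ (injective x) (unique x)))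
    (AllPairs.tabulate⁺ disjoint)
    where
    disjoint : ∀ {x y} → x ≢ y → Disjoint (List.map (f x) (l x)) (List.map (f y) (l y))
    disjoint {x} {y} x≢y (∈x , ∈y) with ∈-map⁻ (f x) ∈x | ∈-map⁻ (f y) ∈y
    ... | _ , _ , refl | _ , _ , eq = x≢y (same-index eq)

-- The factors are the losses from spacing the directions by `g`, from using `S ≥ n / 8` depths, and
-- from `K ≤ 5 d N` in the pigeonhole.
loss : ℕ → ℕ → ℕ
loss g d = g ^ ℕ.pred d ℕ.* 8 ℕ.* (5 ℕ.* d)

-- The last two hypotheses say that `N` is the integer part of the `d`-th root of `n`. Depths are at
-- most `2 + n′ = n - 2`, which leaves room for a shift by 1.
module Construction (D n n′ N g : ℕ) (n≡4+n′ : n ≡ 4 ℕ.+ n′) (20<g : 20 ℕ.< g)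
  (N^d≤n : N ^ suc D ℕ.≤ n) (n<[1+N]^d : n ℕ.< suc N ^ suc D) where

  instance
    n≢0 : ℕ.NonZero n
    n≢0 = subst ℕ.NonZero (sym n≡4+n′) _
    g≢0 : ℕ.NonZero g
    g≢0 = ℕ.>-nonZero (ℕ.≤-<-trans ℕ.z≤n 20<g)

  -- `M` counts the multiples of `g` in `[0 , n]`, the possible slopes in each of `D` coordinates,
  -- and `S` the depths used between `n / 2` and `n - 2`.
  d M S : ℕ
  d = suc D
  M = suc (n ℕ./ g)
  S = suc (n′ ℕ./ 4)

  -- Depths differ by at least 2, so that distinct cubes of a tube do not touch.
  depth : Fin S → ℕ
  depth i = 2 ℕ.+ n′ ∸ 2 ℕ.* toℕ i

  4i≤n′ : ∀ (i : Fin S) → 4 ℕ.* toℕ i ℕ.≤ n′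
  4i≤n′ i = ℕ.≤-trans (ℕ.*-monoʳ-≤ 4 (Fin.toℕ≤pred[n] i))
    (subst (ℕ._≤ n′) (ℕ.*-comm (n′ ℕ./ 4) 4) (ℕ.m/n*n≤m n′ 4))

  depth+2i : ∀ i → depth i ℕ.+ 2 ℕ.* toℕ i ≡ 2 ℕ.+ n′
  depth+2i i = ℕ.m∸n+n≡m (ℕ.≤-trans (ℕ.≤-trans (ℕ.*-monoˡ-≤ (toℕ i) (ℕ.m≤m+n 2 2)) (4i≤n′ i)) (ℕ.m≤n+m n′ 2))

  depth≤ : ∀ i → depth i ℕ.≤ 2 ℕ.+ n′
  depth≤ i = ℕ.m∸n≤m (2 ℕ.+ n′) (2 ℕ.* toℕ i)

  depth≤n : ∀ i → depth i ℕ.≤ n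
  depth≤n i = ℕ.≤-trans (depth≤ i) (ℕ.≤-trans (ℕ.m≤n+m (2 ℕ.+ n′) 2) (ℕ.≤-reflexive (sym n≡4+n′)))

  -- Rays diverge with the depth; staying in the outer half keeps tubes disjoint with a constant
  -- spacing `g`.
  n≤2*depth : ∀ i → n ℕ.≤ 2 ℕ.* depth i
  n≤2*depth i = ℕ.+-cancelʳ-≤ (4 ℕ.* toℕ i) n (2 ℕ.* depth i) (begin
    n ℕ.+ 4 ℕ.* toℕ i                      ≤⟨ ℕ.+-monoʳ-≤ n (4i≤n′ i) ⟩
    n ℕ.+ n′                               ≡⟨ trans (cong (ℕ._+ n′) n≡4+n′) (double n′) ⟩
    2 ℕ.* (2 ℕ.+ n′)                       ≡⟨ cong (2 ℕ.*_) (depth+2i i) ⟨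
    2 ℕ.* (depth i ℕ.+ 2 ℕ.* toℕ i)        ≡⟨ distrib (depth i) (toℕ i) ⟩
    2 ℕ.* depth i ℕ.+ 4 ℕ.* toℕ i          ∎)
    where
    open ℕ.≤-Reasoning
    double : ∀ m → 4 ℕ.+ m ℕ.+ m ≡ 2 ℕ.* (2 ℕ.+ m)
    double = ℕ-solve-∀
    distrib : ∀ x y → 2 ℕ.* (x ℕ.+ 2 ℕ.* y) ≡ 2 ℕ.* x ℕ.+ 4 ℕ.* y
    distrib = ℕ-solve-∀

  depth-apart : ∀ {i j} → i Fin.< j → ¬ (depth i ℕ.≤ suc (depth j))
  depth-apart {i} {j} i<j le = ℕ.<-irrefl refl (begin-strict
    2 ℕ.+ n′                                ≡⟨ depth+2i i ⟨
    depth i ℕ.+ 2 ℕ.* toℕ i                 ≤⟨ ℕ.+-monoˡ-≤ (2 ℕ.* toℕ i) le ⟩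
    suc (depth j) ℕ.+ 2 ℕ.* toℕ i           <⟨ ℕ.n<1+n _ ⟩
    2 ℕ.+ depth j ℕ.+ 2 ℕ.* toℕ i           ≡⟨ shift (depth j) (toℕ i) ⟩
    depth j ℕ.+ 2 ℕ.* suc (toℕ i)           ≤⟨ ℕ.+-monoʳ-≤ (depth j) (ℕ.*-monoʳ-≤ 2 i<j) ⟩
    depth j ℕ.+ 2 ℕ.* toℕ j                 ≡⟨ depth+2i j ⟩
    2 ℕ.+ n′                                ∎)
    where
    open ℕ.≤-Reasoning
    shift : ∀ x y → 2 ℕ.+ x ℕ.+ 2 ℕ.* y ≡ x ℕ.+ 2 ℕ.* suc y
    shift = ℕ-solve-∀

  depth-injective : ∀ {i j} → depth i ℕ.≤ suc (depth j) → depth j ℕ.≤ suc (depth i) → i ≡ j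
  depth-injective {i} {j} i≤ j≤ with Fin.<-cmp i j
  ... | tri< i<j _ _ = contradiction i≤ (depth-apart i<j)
  ... | tri≈ _ i≡j _ = i≡j
  ... | tri> _ _ i>j = contradiction j≤ (depth-apart i>j)

  slope : Fin (M ^ D) → Fin D → ℕ
  slope x j = toℕ (finToFun {M} {D} x j)

  -- The entry `n` makes the first coordinate of a core cell exactly its depth, and is the
  -- coordinate that eliminates `τ` in `near-rays-≤`.
  direction : Fin (M ^ D) → Fin d → ℕ
  direction x zero    = n
  direction x (suc j) = g ℕ.* slope x j

  direction≤n : ∀ x j → direction x j ℕ.≤ n
  direction≤n x zero    = ℕ.≤-refl
  direction≤n x (suc j) = ℕ.≤-trans (ℕ.*-monoʳ-≤ g (Fin.toℕ≤pred[n] (finToFun {M} {D} x j)))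
    (subst (ℕ._≤ n) (ℕ.*-comm (n ℕ./ g) g) (ℕ.m/n*n≤m n g))

  core : Fin (M ^ D) → Fin S → Fin d → ℕ
  core x i j = depth i ℕ.* direction x j ℕ./ n

  K : ℕ
  K = suc (4 ℕ.* (d ℕ.* N))

  sheetAlong : ∀ x → Sheet (core x) K
  sheetAlong x = sheet n<[1+N]^d (direction x) (direction≤n x) depth depth≤n

  module _ (x : Fin (M ^ D)) where
    open Sheet (sheetAlong x) public

  cell : Fin (M ^ D) → Fin S → Fin d → ℕ
  cell x i j = core x i j ℕ.+ shift x j

  core≤depth : ∀ x i j → core x i j ℕ.≤ depth i
  core≤depth x i j = ℕ.≤-trans (ℕ./-monoˡ-≤ n (ℕ.*-monoʳ-≤ (depth i) (direction≤n x j)))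
    (ℕ.≤-reflexive (ℕ.m*n/n≡m (depth i) n))

  cell<n : ∀ x i j → cell x i j ℕ.< n
  cell<n x i j = subst (cell x i j ℕ.<_) (sym n≡4+n′) (ℕ.s≤s (ℕ.≤-trans
    (ℕ.+-mono-≤ (ℕ.≤-trans (core≤depth x i j) (depth≤ i)) (shift≤1 x j))
    (ℕ.≤-reflexive (ℕ.+-comm (2 ℕ.+ n′) 1))))

  cell-zero : ∀ x i → cell x i zero ≡ depth i ℕ.+ shift x zero
  cell-zero x i = cong (ℕ._+ shift x zero) (ℕ.m*n/n≡m (depth i) n)

  -- Rounding down and shifting up each move a coordinate by at most 1, in opposite directions, so
  -- the errors do not add.
  cell-near-ray : ∀ x i j → NearRay n (depth i ℕ.* direction x j) (cell x i j)
  cell-near-ray x i j = near-ray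
    (begin
      n ℕ.* (core x i j ℕ.+ shift x j)          ≡⟨ ℕ.*-distribˡ-+ n (core x i j) (shift x j) ⟩
      n ℕ.* core x i j ℕ.+ n ℕ.* shift x j      ≤⟨ ℕ.+-mono-≤
        (ℕ.≤-trans (ℕ.≤-reflexive (ℕ.*-comm n (core x i j))) (ℕ.m/n*n≤m y n))
        (ℕ.≤-trans (ℕ.*-monoʳ-≤ n (shift≤1 x j)) (ℕ.≤-reflexive (ℕ.*-identityʳ n))) ⟩
      y ℕ.+ n                                   ∎)
    (begin
      y                                         ≡⟨ ℕ.m≡m%n+[m/n]*n y n ⟩
      y ℕ.% n ℕ.+ core x i j ℕ.* n              ≡⟨ ℕ.+-comm (y ℕ.% n) (core x i j ℕ.* n) ⟩
      core x i j ℕ.* n ℕ.+ y ℕ.% n              ≤⟨ ℕ.+-mono-≤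
        (ℕ.≤-trans (ℕ.≤-reflexive (ℕ.*-comm (core x i j) n)) (ℕ.*-monoʳ-≤ n (ℕ.m≤m+n (core x i j) (shift x j))))
        (ℕ.m%n≤n y n) ⟩
      n ℕ.* cell x i j ℕ.+ n                    ∎)
    where
    open ℕ.≤-Reasoning
    y = depth i ℕ.* direction x j

  cube : Fin (M ^ D) → Fin S → Cube d n
  cube x i = Vec.tabulate (λ j → fromℕ< (cell<n x i j))

  corner-cube : ∀ x i j → corner (cube x i) j ≡ cell x i j
  corner-cube x i j = trans (cong toℕ (Vec.lookup∘tabulate (λ j → fromℕ< (cell<n x i j)) j))
    (Fin.toℕ-fromℕ< (cell<n x i j))

  -- Used with `τ = 1` for the disjointness of tubes, and with the parameter of a point on a sight
  -- line for visibility.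
  directions-separated : ∀ {x y i j} τ → ∣ τ ∣ ≤ ⟦ 2 ⟧ →
    (∀ k → ∣ τ * ⟦ cell x i k ⟧ - ⟦ cell y j k ⟧ ∣ ≤ ⟦ 2 ⟧) → x ≡ y
  directions-separated {x} {y} {i} {j} τ τ≤2 close = finToFun-injective {M} {D} x y λ k →
    Fin.toℕ-injective (near-rays-≡ {s = depth i} {depth j} τ n≢0 (n≤2*depth j) 20<g
      (cell-near-ray x i (suc k)) (cell-near-ray y j (suc k))
      (cell-near-ray x i zero) (cell-near-ray y j zero)
      (direction≤n x (suc k)) τ≤2 (close (suc k)) (close zero))

  shared-cube : ∀ {x y i j} → cube x i ≡ cube y j → x ≡ y
  shared-cube {x} {y} {i} {j} eq = directions-separated {x} {y} {i} {j} 1ℚ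
    (⟦⟧-mono-≤ {1} {2} (ℕ.s≤s ℕ.z≤n)) λ k → begin
      ∣ 1ℚ * ⟦ cell x i k ⟧ - ⟦ cell y j k ⟧ ∣
        ≡⟨ cong (λ z → ∣ 1ℚ * ⟦ z ⟧ - ⟦ cell y j k ⟧ ∣) (same k) ⟩
      ∣ 1ℚ * ⟦ cell y j k ⟧ - ⟦ cell y j k ⟧ ∣
        ≡⟨ cong ∣_∣ (solve 1 (λ z → con 1ℚ :* z :- z := con 0ℚ) refl ⟦ cell y j k ⟧) ⟩
      0ℚ
        ≤⟨ 0≤⟦ 2 ⟧ ⟩
      ⟦ 2 ⟧ ∎
    where
    open ℚ.≤-Reasoning
    same : ∀ k → cell x i k ≡ cell y j k
    same k = trans (sym (corner-cube x i k)) (trans (cong (λ Q → corner Q k) eq) (corner-cube y j k))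

  depth-near : ∀ {x i j} → cell x i zero ℕ.≤ suc (cell x j zero) → depth i ℕ.≤ suc (depth j)
  depth-near {x} {i} {j} le = ℕ.+-cancelʳ-≤ (shift x zero) (depth i) (suc (depth j))
    (subst₂ (λ a b → a ℕ.≤ suc b) (cell-zero x i) (cell-zero x j) le)

  cube-injective : ∀ x {i j} → cube x i ≡ cube x j → i ≡ j
  cube-injective x {i} {j} eq = depth-injective
    (depth-near {x} {i} {j} (ℕ.m≤n⇒m≤1+n (ℕ.≤-reflexive same)))
    (depth-near {x} {j} {i} (ℕ.m≤n⇒m≤1+n (ℕ.≤-reflexive (sym same))))
    where
    same : cell x i zero ≡ cell x j zero
    same = trans (sym (corner-cube x i zero)) (trans (cong (λ Q → corner Q zero) eq) (corner-cube x j zero))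

  cubes : Fin (M ^ D) → List (Cube d n)
  cubes x = List.map (cube x) (members x)

  allCubes : List (Cube d n)
  allCubes = concat (List.tabulate cubes)

  ∈-allCubes⁻ : ∀ {Q} → Q ∈ allCubes → ∃₂ λ x i → i ∈ members x × Q ≡ cube x i
  ∈-allCubes⁻ = ∈-concat-tabulate⁻ cube members

  unique : Unique allCubes
  unique = unique-concat-tabulate cube members distinct cube-injective
    (λ {x} {y} {i} {j} → shared-cube {x} {y} {i} {j})

  configuration : Configuration d n
  configuration = record
    { obstructing  = allCubes
    ; not-observer = λ Q∈ observer →
        let x , i , _ , Q≡ = ∈-allCubes⁻ Q∈
            cell≡0 = trans (sym (corner-cube x i zero)) (subst (λ Q → corner Q zero ≡ 0) Q≡ (observer zero))
            depth≡0 = ℕ.m+n≡0⇒m≡0 (depth i) (trans (sym (cell-zero x i)) cell≡0)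
        in contradiction (n≤2*depth i) (subst₂ (λ m s → ¬ (m ℕ.≤ 2 ℕ.* s)) (sym n≡4+n′) (sym depth≡0) λ ())
    }

  on-sheet : ∀ x {i} → i ∈ members x → form x ∙ corner (cube x i) ≡ level x
  on-sheet x {i} i∈ = trans (∙-cong (form x) (corner-cube x i)) (on-level x i∈)

  -- Visibility of all cubes

  start : Fin (M ^ D) → Fin d → ℕ
  start x k = topCorner (form x k)

  -- The sight line joins the corners of the observer and of the target at which the form is
  -- largest.
  end : Fin (M ^ D) → Fin S → Fin d → ℕ
  end x i k = start x k ℕ.+ corner (cube x i) k

  SightMeets : Fin (M ^ D) → Fin S → Cube d n → Set
  SightMeets x i = SegmentMeets (fromℕ ∘ start x) (fromℕ ∘ end x i)

  meets-same-tube : ∀ {x i y j} → SightMeets x i (cube y j) → x ≡ y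
  meets-same-tube {x} {i} {y} {j} meets =
    let τ , near = segment⇒near (start x) (corner (cube x i)) (cube y j) meets 1ℚ (ℚ.positive⁻¹ 1ℚ)
        τ≤2 , close = near-bounds (λ k → topCorner≤1 (form x k)) near
    in directions-separated {x} {y} {i} {j} τ τ≤2 λ k →
         subst₂ (λ a b → ∣ τ * ⟦ a ⟧ - ⟦ b ⟧ ∣ ≤ ⟦ 2 ⟧) (corner-cube x i k) (corner-cube y j k) (close k)

  -- Both cubes are on one level, so `near-same-form` puts their first coordinates within 1 of each
  -- other. These are the depths plus a common shift, and distinct depths differ by at least 2.
  meets-only-end : ∀ {x i j} → i ∈ members x → j ∈ members x → SightMeets x i (cube x j) → j ≡ i
  meets-only-end {x} {i} {j} i∈ j∈ meets =
    let j≤i , i≤j = near-same-form (form x) (corner (cube x i)) (cube x j) (level<0 x)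
                      (on-sheet x i∈) (on-sheet x j∈) meets zero
    in depth-injective
         (depth-near {x} {j} {i} (subst₂ (λ a b → a ℕ.≤ suc b) (corner-cube x j zero) (corner-cube x i zero) j≤i))
         (depth-near {x} {i} {j} (subst₂ (λ a b → a ℕ.≤ suc b) (corner-cube x i zero) (corner-cube x j zero) i≤j))

  meets-own-cube : ∀ {x y i j} → x ≡ y → i ∈ members x → j ∈ members y →
                   SightMeets x i (cube y j) → cube y j ≡ cube x i
  meets-own-cube {x} refl i∈ j∈ meets = cong (cube x) (meets-only-end i∈ j∈ meets)

  cube-visible : ∀ x i → i ∈ members x → cube x i ∈ allCubes → Visible configuration (cube x i)
  cube-visible x i i∈ Q∈ = record
    { is-obstructing = Q∈
    ; from           = fromℕ ∘ start x
    ; to             = fromℕ ∘ end x i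
    ; from∈observer  = λ k → fromℕ-mono-≤ (ℕ.z≤n {start x k}) , fromℕ-mono-≤ (topCorner≤1 (form x k))
    ; to∈Q           = λ k → fromℕ-mono-≤ (ℕ.m≤n+m (corner (cube x i) k) (start x k)) ,
                             fromℕ-mono-≤ (ℕ.+-monoˡ-≤ (corner (cube x i) k) (topCorner≤1 (form x k)))
    ; unobstructed   = λ {Q′} Q′∈ Q′≢Q meets →
        let y , j , j∈ , Q′≡ = ∈-allCubes⁻ Q′∈
            meets′ = subst (SightMeets x i) Q′≡ meets
        in Q′≢Q (trans Q′≡ (meets-own-cube (meets-same-tube {x} {i} {y} {j} meets′) i∈ j∈ meets′))
    }

  visible : ∀ {Q} → Q ∈ allCubes → Visible configuration Q
  visible Q∈ =
    let x , i , i∈ , Q≡ = ∈-allCubes⁻ Q∈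
    in subst (Visible configuration) (sym Q≡) (cube-visible x i i∈ (subst (_∈ allCubes) Q≡ Q∈))

  visible-count : NumberVisible configuration (length allCubes)
  visible-count = allCubes , unique , (λ Q → mk⇔ visible Visible.is-obstructing) , refl

  -- Counting the visible cubes

  C : ℕ
  C = loss g d

  1≤N : 1 ℕ.≤ N
  1≤N = ℕ.n≢0⇒n>0 λ N≡0 → contradiction n<[1+N]^d
    (ℕ.≤⇒≯ (ℕ.≤-trans (ℕ.≤-reflexive (trans (cong (λ z → suc z ^ d) N≡0) (ℕ.^-zeroˡ d))) (ℕ.>-nonZero⁻¹ n)))

  K≤5dN : K ℕ.≤ 5 ℕ.* d ℕ.* N
  K≤5dN = begin
    1 ℕ.+ 4 ℕ.* (d ℕ.* N)            ≤⟨ ℕ.+-monoˡ-≤ (4 ℕ.* (d ℕ.* N)) (ℕ.*-mono-≤ (ℕ.s≤s (ℕ.z≤n {D})) 1≤N) ⟩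
    5 ℕ.* (d ℕ.* N)                  ≡⟨ ℕ.*-assoc 5 d N ⟨
    5 ℕ.* d ℕ.* N                    ∎
    where open ℕ.≤-Reasoning

  n≤gM : n ℕ.≤ g ℕ.* M
  n≤gM = ℕ.<⇒≤ (subst (n ℕ.<_) (ℕ.*-comm M g) (subst (ℕ._< M ℕ.* g) (sym (ℕ.m≡m%n+[m/n]*n n g))
    (ℕ.+-monoˡ-< (n ℕ./ g ℕ.* g) (ℕ.m%n<n n g))))

  n≤8S : n ℕ.≤ 8 ℕ.* S
  n≤8S = begin
    n                                           ≡⟨ n≡4+n′ ⟩
    4 ℕ.+ n′                                    ≡⟨ cong (4 ℕ.+_) (ℕ.m≡m%n+[m/n]*n n′ 4) ⟩
    4 ℕ.+ (n′ ℕ.% 4 ℕ.+ n′ ℕ./ 4 ℕ.* 4)         ≤⟨ ℕ.+-monoʳ-≤ 4 (ℕ.+-mono-≤ (ℕ.m%n≤n n′ 4) (ℕ.*-monoʳ-≤ (n′ ℕ./ 4) (ℕ.m≤m+n 4 4))) ⟩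
    4 ℕ.+ (4 ℕ.+ n′ ℕ./ 4 ℕ.* 8)                ≡⟨ factor (n′ ℕ./ 4) ⟩
    8 ℕ.* S                                     ∎
    where
    open ℕ.≤-Reasoning
    factor : ∀ x → 4 ℕ.+ (4 ℕ.+ x ℕ.* 8) ≡ 8 ℕ.* suc x
    factor = ℕ-solve-∀

  -- There are `M ^ D` tubes with at least `S / K` cubes each, where `M ≥ n / g`, `S ≥ n / 8` and
  -- `K ≤ 5 d N`.
  n^d≤CmN : n ^ d ℕ.≤ C ℕ.* length allCubes ℕ.* N
  n^d≤CmN = begin
    n ℕ.* n ^ D
      ≤⟨ ℕ.*-mono-≤ n≤8S (ℕ.^-monoˡ-≤ D n≤gM) ⟩
    8 ℕ.* S ℕ.* (g ℕ.* M) ^ D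
      ≡⟨ cong (8 ℕ.* S ℕ.*_) (^-distribʳ-* D g M) ⟩
    8 ℕ.* S ℕ.* (g ^ D ℕ.* M ^ D)
      ≡⟨ rearrange S (g ^ D) (M ^ D) ⟩
    g ^ D ℕ.* 8 ℕ.* (M ^ D ℕ.* S)
      ≤⟨ ℕ.*-monoʳ-≤ (g ^ D ℕ.* 8) (*-length-concat {K = K} (M ^ D) cubes λ x →
           subst (λ z → S ℕ.≤ K ℕ.* z) (sym (List.length-map (cube x) (members x))) (large x)) ⟩
    g ^ D ℕ.* 8 ℕ.* (K ℕ.* m)
      ≤⟨ ℕ.*-monoʳ-≤ (g ^ D ℕ.* 8) (ℕ.*-monoˡ-≤ m K≤5dN) ⟩
    g ^ D ℕ.* 8 ℕ.* (5 ℕ.* d ℕ.* N ℕ.* m)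
      ≡⟨ rearrange′ (g ^ D ℕ.* 8) (5 ℕ.* d) N m ⟩
    C ℕ.* m ℕ.* N ∎
    where
    open ℕ.≤-Reasoning
    m = length allCubes
    rearrange : ∀ s t u → 8 ℕ.* s ℕ.* (t ℕ.* u) ≡ t ℕ.* 8 ℕ.* (u ℕ.* s)
    rearrange = ℕ-solve-∀
    rearrange′ : ∀ x y N m → x ℕ.* (y ℕ.* N ℕ.* m) ≡ x ℕ.* y ℕ.* m ℕ.* N
    rearrange′ = ℕ-solve-∀

  -- In the `d`-th power `N ^ d ≤ n` applies, and one factor `n` cancels. As `d` is a successor,
  -- `n ^ (d * d)` unfolds to `n * n ^ (d * d ∸ 1)`.
  n^[dd-1]≤[Cm]^d : n ^ (d ℕ.* d ∸ 1) ℕ.≤ (C ℕ.* length allCubes) ^ d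
  n^[dd-1]≤[Cm]^d = ℕ.*-cancelˡ-≤ n (begin
    n ^ (d ℕ.* d)                           ≡⟨ ℕ.^-*-assoc n d d ⟨
    (n ^ d) ^ d                             ≤⟨ ℕ.^-monoˡ-≤ d n^d≤CmN ⟩
    (C ℕ.* m ℕ.* N) ^ d                     ≡⟨ ^-distribʳ-* d (C ℕ.* m) N ⟩
    (C ℕ.* m) ^ d ℕ.* N ^ d                 ≤⟨ ℕ.*-monoʳ-≤ ((C ℕ.* m) ^ d) N^d≤n ⟩
    (C ℕ.* m) ^ d ℕ.* n                     ≡⟨ ℕ.*-comm ((C ℕ.* m) ^ d) n ⟩
    n ℕ.* (C ℕ.* m) ^ d                     ∎)
    where
    open ℕ.≤-Reasoning
    m = length allCubes

many-visible : ∀ D n → n > 3 →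
  Σ (Configuration (suc D) n) λ O → Σ ℕ λ m →
    NumberVisible O m × n ^ (suc D ℕ.* suc D ∸ 1) ℕ.≤ (loss 21 (suc D) ℕ.* m) ^ suc D
many-visible D n n>3 = configuration , length allCubes , visible-count , n^[dd-1]≤[Cm]^d
  where
  -- 21 is the least admissible spacing.
  open Construction D n (n ∸ 4) (⌊root⌋ (suc D) n) 21 (sym (ℕ.m+[n∸m]≡n n>3)) ℕ.≤-refl
    (rootUpTo-lower (suc D) n n)
    -- The search for the root starts at `n`, which is high enough because `n < (1 + n) ^ d`.
    (rootUpTo-upper (suc D) n n (ℕ.≤-trans (ℕ.≤-reflexive (sym (ℕ.^-identityʳ (suc n))))
      (ℕ.^-monoʳ-≤ (suc n) (ℕ.s≤s (ℕ.z≤n {D})))))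

-- Passage to the real power

rootSeq-≤ : ∀ q .{{_ : ℕ.NonZero q}} a X k → a ℕ.≤ X ^ q → rootSeq q a k ≤ ⟦ X ⟧
rootSeq-≤ q a X k a≤X^q = ℚ.toℚᵘ-cancel-≤ (begin
  ℚ.toℚᵘ (rootSeq q a k)  ≃⟨ ℚ.toℚᵘ-fromℚᵘ (ℚᵘ.mkℚᵘ (+ rootNum q a k) k) ⟩
  ℚᵘ.mkℚᵘ (+ rootNum q a k) k
    ≤⟨ ℚᵘ.*≤* (subst₂ ℤ._≤_ (sym (ℤ.*-identityʳ (+ rootNum q a k))) (ℤ.pos-* X (suc k)) (ℤ.+≤+ r≤)) ⟩
  ℚᵘ.mkℚᵘ (+ X) 0         ≃⟨ ι-toℚᵘ (+ X) ⟨
  ℚ.toℚᵘ ⟦ X ⟧            ∎)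
  where
  open ℚᵘ.≤-Reasoning
  -- The approximations are rounded down, so a comparison of `q`-th powers gives the bound at every
  -- index.
  r≤ : rootNum q a k ℕ.≤ X ℕ.* suc k
  r≤ = ℕ.≮⇒≥ λ lt → ℕ.<⇒≱ (ℕ.^-monoˡ-< q lt) (ℕ.≤-trans (rootNum-lower q a k)
    (ℕ.≤-trans (ℕ.*-monoˡ-≤ (suc k ^ q) a≤X^q) (ℕ.≤-reflexive (sym (^-distribʳ-* q X (suc k))))))

theorem4p2 : (d : ℕ) (d>3 : d > 3) →
    Σ ℝ λ c → fromℕ 0 <ᵣ c ×
    ((n : ℕ) → n > 3 →
    Σ (Configuration d n) λ O → Σ ℕ λ m →
    NumberVisible O m ×
    c *ᵣ pow n (d ℕ.* d ∸ 1) d {{>-nonZero (m<n⇒0<n d>3)}} ≤ᵣ fromℕ m)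
theorem4p2 d@(suc D) d>3 =
  -- `shrink` returns half of its second argument over the first, so the argument 2 yields
  -- `c = 1 / C`.
  let c , c>0 , Cc≡1 = shrink ⟦ C ⟧ ⟦ 2 ⟧ (0<⟦ C ⟧ 1≤C) (0<⟦ 2 ⟧ (ℕ.s≤s ℕ.z≤n))
  in fromℚ c , (c , c>0 , 0 , λ _ → ℚ.≤-reflexive (ℚ.+-identityˡ c)) , λ n n>3 →
    let O , m , visible , n^[dd-1]≤ = many-visible D n n>3
    -- Every approximation of the root already obeys the bound, whence the threshold `0`.
    in O , m , visible , λ ε ε>0 → 0 , λ {k} _ → begin
      c * rootSeq d (n ^ (d ℕ.* d ∸ 1)) k
        ≤⟨ ℚ.*-monoˡ-≤-nonNeg c {{ℚ.nonNegative (ℚ.<⇒≤ c>0)}}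
             (rootSeq-≤ d (n ^ (d ℕ.* d ∸ 1)) (C ℕ.* m) k n^[dd-1]≤) ⟩
      c * ⟦ C ℕ.* m ⟧
        ≡⟨ cong (c *_) (⟦⟧-* C m) ⟩
      c * (⟦ C ⟧ * ⟦ m ⟧)
        ≡⟨ solve 3 (λ c C m → c :* (C :* m) := C :* c :* m) refl c ⟦ C ⟧ ⟦ m ⟧ ⟩
      ⟦ C ⟧ * c * ⟦ m ⟧
        ≡⟨ cong (_* ⟦ m ⟧) Cc≡1 ⟩
      1ℚ * ⟦ m ⟧
        ≡⟨ trans (ℚ.*-identityˡ ⟦ m ⟧) (sym (ℚ.+-identityʳ ⟦ m ⟧)) ⟩
      ⟦ m ⟧ + 0ℚ
        ≤⟨ ℚ.+-monoʳ-≤ ⟦ m ⟧ (ℚ.<⇒≤ ε>0) ⟩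
      ⟦ m ⟧ + ε ∎
  where
  open ℚ.≤-Reasoning
  C = loss 21 d
  1≤C : 1 ℕ.≤ C
  1≤C = ℕ.*-mono-≤ (ℕ.*-mono-≤ (ℕ.m^n>0 21 D) (ℕ.s≤s (ℕ.z≤n {7}))) (ℕ.s≤s (ℕ.z≤n {D ℕ.+ 4 ℕ.* d}))
  0<⟦_⟧ : ∀ n → 1 ℕ.≤ n → 0ℚ ℚ.< ⟦ n ⟧
  0<⟦ n ⟧ 1≤n = ℚ.<-≤-trans (ℚ.positive⁻¹ 1ℚ) (⟦⟧-mono-≤ 1≤n)
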